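{- There is a positive constant $\varepsilon$ such that any graph $G$ on vertex set $[n]$ with less than $\varepsilon \frac{n^2}{k^2 \log k}$ edges contains a $k$-term independent arithmetic progression.
   Context: Here $[n] = \{1, \ldots, n\}$. A $k$-term arithmetic progression is a set of the form $\{a, a+d, \ldots, a+(k-1)d\}$ with $d \geq 1$ an integer. Given a graph with vertex set $[n]$, a $k$-term arithmetic progression (of elements of $[n]$) is said to be independent if it is an independent set in the graph, i.e., no two of its elements are joined by an edge. All logarithms are to base $e$.
   Formalization: The formal statement assumes 2 ≤ k ≤ n: for k = 1 the bound divides by log 1 = 0, and for 1 ≤ n < k the edgeless graph meets the edge bound although [n] contains no k-term progression. -}

module Defs where

open import Data.Nat as ℕ using (ℕ; zero; suc; z≤n; s≤s)
import Data.Nat.Properties as ℕₚ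
open import Data.Nat.Solver using (module +-*-Solver)
open import Data.Integer as ℤ using (+_; +[1+_])
import Data.Integer.Properties as ℤₚ
open import Data.Rational
  using (ℚ; mkℚ; 0ℚ; 1ℚ; ½; _+_; _*_; _-_; -_; _/_; 1/_; ∣_∣; _≤_; _<_;
         positive; nonNegative; ≢-nonZero; toℚᵘ; *≤*; *<*)
open import Data.Rational.Properties
import Data.Rational.Unnormalised as ℚᵘ
import Data.Rational.Unnormalised.Properties as ℚᵘₚ
open import Data.Rational.Solver using () renaming (module +-*-Solver to ℚ-Solver)
open import Data.Fin using (Fin; toℕ)
import Data.Fin.Properties as Finₚ
open import Data.Fin.Subset using (Subset; _∈_)
open import Data.List using (List; length; filter; allFin; cartesianProduct)
open import Data.Product using (∃-syntax; _×_; _,_)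
open import Data.Sum using (inj₁; inj₂)
open import Function.Bundles using (_⇔_)
open import Level using (0ℓ)
open import Relation.Binary using (Rel; Symmetric; Decidable)
open import Relation.Binary.PropositionalEquality
open import Relation.Nullary using (¬_; yes; no; contradiction)
open import Relation.Nullary.Decidable using (_×-dec_)

private
  ∣∣-bound : ∀ {p q} → p ≤ q → - p ≤ q → ∣ p ∣ ≤ q
  ∣∣-bound {p} p≤q -p≤q with ∣p∣≡p∨∣p∣≡-p p
  ... | inj₁ e = subst (_≤ _) (sym e) p≤q
  ... | inj₂ e = subst (_≤ _) (sym e) -p≤q

  *-mono-≤ : ∀ {p q r s} → 0ℚ ≤ p → 0ℚ ≤ s → p ≤ q → r ≤ s → p * r ≤ q * s
  *-mono-≤ {p} {q} {r} {s} 0≤p 0≤s p≤q r≤s = ≤-trans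
    (*-monoˡ-≤-nonNeg p {{nonNegative 0≤p}} r≤s)
    (*-monoʳ-≤-nonNeg s {{nonNegative 0≤s}} p≤q)

  *-pos : ∀ {p q} → 0ℚ < p → 0ℚ < q → 0ℚ < p * q
  *-pos {p} {q} 0<p 0<q = subst (_< p * q) (*-zeroʳ p)
    (*-monoʳ-<-pos p {{positive 0<p}} 0<q)

  +-pos : ∀ {p q} → 0ℚ ≤ p → 0ℚ < q → 0ℚ < p + q
  +-pos {p} {q} 0≤p 0<q = subst (_< p + q) (+-identityʳ 0ℚ) (+-mono-≤-< 0≤p 0<q)

  ⊔₁ : ∀ {m n o} → m ℕ.⊔ n ℕ.≤ o → m ℕ.≤ o
  ⊔₁ {m} {n} = ℕₚ.≤-trans (ℕₚ.m≤m⊔n m n)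

  ⊔₂ : ∀ {m n o} → m ℕ.⊔ n ℕ.≤ o → n ℕ.≤ o
  ⊔₂ {m} {n} = ℕₚ.≤-trans (ℕₚ.m≤n⊔m m n)

  module Identities where
    open ℚ-Solver

    split : ∀ a b → a ≡ b + (a - b)
    split = solve 2 (λ a b → a := b :+ (a :- b)) refl

    product-difference : ∀ a b c d → a * b - c * d ≡ a * (b - d) + d * (a - c)
    product-difference =
      solve 4 (λ a b c d → a :* b :- c :* d := a :* (b :- d) :+ d :* (a :- c)) refl

    reassociate : ∀ d r e → d * (r * e) ≡ (r * d) * e
    reassociate = solve 3 (λ d r e → d :* (r :* e) := (r :* d) :* e) refl

    clear-recips : ∀ r s a b → (r - s) * (a * b) ≡ (r * a) * b - (s * b) * a
    clear-recips =
      solve 4 (λ r s a b → (r :- s) :* (a :* b) := (r :* a) :* b :- (s :* b) :* a) refl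

    rotate : ∀ p h u → p + (h + u) ≡ (u + h) + p
    rotate = solve 3 (λ p h u → p :+ (h :+ u) := (u :+ h) :+ p) refl

    cancel : ∀ r e → (r + e) - r ≡ e
    cancel = solve 2 (λ r e → (r :+ e) :- r := e) refl

    neg-difference : ∀ a b → - (a - b) ≡ b - a
    neg-difference = solve 2 (λ a b → :- (a :- b) := b :- a) refl

  open Identities

-- Total reciprocal, with recip 0 = 0.
recip : ℚ → ℚ
recip q with q ≟ 0ℚ
... | yes _ = 0ℚ
... | no q≢0 = (1/ q) {{≢-nonZero q≢0}}

recip-inverse : ∀ q → 0ℚ < q → recip q * q ≡ 1ℚ
recip-inverse q 0<q with q ≟ 0ℚ
... | yes refl = contradiction 0<q (<-irrefl refl)
... | no q≢0 = *-inverseˡ q {{≢-nonZero q≢0}}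

recip-pos : ∀ q → 0ℚ < q → 0ℚ < recip q
recip-pos q 0<q = *-cancelʳ-<-nonNeg q {{nonNegative (<⇒≤ 0<q)}}
  (subst₂ _<_ (sym (*-zeroˡ q)) (sym (recip-inverse q 0<q)) (*<* (ℤ.+<+ (s≤s z≤n))))

-- Real numbers as Cauchy sequences of rationals; x <ᴿ y asks for an eventual
-- positive rational gap between the sequences.
Cauchy : (ℕ → ℚ) → Set
Cauchy x = ∀ δ → 0ℚ < δ → ∃[ N ] (∀ m n → N ℕ.≤ m → N ℕ.≤ n → ∣ x m - x n ∣ ≤ δ)

record ℝ : Set where
  field
    seq    : ℕ → ℚ
    cauchy : Cauchy seq

open ℝ public

infix 4 _<ᴿ_

_<ᴿ_ : Rel ℝ 0ℓ
x <ᴿ y = ∃[ δ ] 0ℚ < δ × (∃[ N ] (∀ n → N ℕ.≤ n → seq x n + δ ≤ seq y n))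

fromℚ : ℚ → ℝ
fromℚ q .seq _ = q
fromℚ q .cauchy δ 0<δ =
  0 , λ _ _ _ _ → subst (λ p → ∣ p ∣ ≤ δ) (sym (+-inverseʳ q)) (<⇒≤ 0<δ)

fromℕ : ℕ → ℝ
fromℕ n = fromℚ (+ n / 1)

0ᴿ : ℝ
0ᴿ = fromℚ 0ℚ

private
  bounded : ∀ x → Cauchy x →
            ∃[ B ] 0ℚ < B × (∃[ N ] (∀ n → N ℕ.≤ n → ∣ x n ∣ ≤ B))
  bounded x cx with cx 1ℚ (*<* (ℤ.+<+ (s≤s z≤n)))
  ... | N , h = ∣ x N ∣ + 1ℚ , +-pos (0≤∣p∣ (x N)) (*<* (ℤ.+<+ (s≤s z≤n))) , N ,
    λ n N≤n → begin
      ∣ x n ∣                   ≡⟨ cong ∣_∣ (split (x n) (x N)) ⟩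
      ∣ x N + (x n - x N) ∣     ≤⟨ ∣p+q∣≤∣p∣+∣q∣ (x N) (x n - x N) ⟩
      ∣ x N ∣ + ∣ x n - x N ∣   ≤⟨ +-monoʳ-≤ ∣ x N ∣ (h n N N≤n ℕₚ.≤-refl) ⟩
      ∣ x N ∣ + 1ℚ              ∎
    where open ≤-Reasoning

  product-close : ∀ a b c d B C η → 0ℚ ≤ η → ∣ a ∣ ≤ B → ∣ d ∣ ≤ C →
                  ∣ a - c ∣ ≤ η → ∣ b - d ∣ ≤ η → ∣ a * b - c * d ∣ ≤ (B + C) * η
  product-close a b c d B C η 0≤η a≤B d≤C a-c b-d = begin
    ∣ a * b - c * d ∣                      ≡⟨ cong ∣_∣ (product-difference a b c d) ⟩
    ∣ a * (b - d) + d * (a - c) ∣          ≤⟨ ∣p+q∣≤∣p∣+∣q∣ (a * (b - d)) (d * (a - c)) ⟩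
    ∣ a * (b - d) ∣ + ∣ d * (a - c) ∣
      ≡⟨ cong₂ _+_ (∣p*q∣≡∣p∣*∣q∣ a (b - d)) (∣p*q∣≡∣p∣*∣q∣ d (a - c)) ⟩
    ∣ a ∣ * ∣ b - d ∣ + ∣ d ∣ * ∣ a - c ∣
      ≤⟨ +-mono-≤ (*-mono-≤ {∣ a ∣} {B} {∣ b - d ∣} {η} (0≤∣p∣ a) 0≤η a≤B b-d)
                  (*-mono-≤ {∣ d ∣} {C} {∣ a - c ∣} {η} (0≤∣p∣ d) 0≤η d≤C a-c) ⟩
    B * η + C * η                          ≡⟨ sym (*-distribʳ-+ η B C) ⟩
    (B + C) * η                            ∎
    where open ≤-Reasoning

  rescale : ∀ D δ → 0ℚ < D → 0ℚ < δ → ∃[ η ] 0ℚ < η × D * η ≡ δ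
  rescale D δ 0<D 0<δ = recip D * δ , *-pos {recip D} {δ} (recip-pos D 0<D) 0<δ ,
    trans (reassociate D (recip D) δ)
      (trans (cong (_* δ) (recip-inverse D 0<D)) (*-identityˡ δ))

  *-cauchy : ∀ x y → Cauchy x → Cauchy y → Cauchy (λ n → x n * y n)
  *-cauchy x y cx cy δ 0<δ = go (bounded x cx) (bounded y cy)
    where
    Bound : (ℕ → ℚ) → Set
    Bound z = ∃[ B ] 0ℚ < B × (∃[ N ] (∀ n → N ℕ.≤ n → ∣ z n ∣ ≤ B))
    Close : (ℕ → ℚ) → ℚ → Set
    Close z η = ∃[ N ] (∀ m n → N ℕ.≤ m → N ℕ.≤ n → ∣ z m - z n ∣ ≤ η)
    combine : ∀ B C η N₁ N₂ → 0ℚ ≤ η → (B + C) * η ≡ δ →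
              (∀ n → N₁ ℕ.≤ n → ∣ x n ∣ ≤ B) → (∀ n → N₂ ℕ.≤ n → ∣ y n ∣ ≤ C) →
              Close x η → Close y η → Close (λ n → x n * y n) δ
    combine B C η N₁ N₂ 0≤η Dη≡δ hB hC (N₃ , hx) (N₄ , hy) =
      (N₁ ℕ.⊔ N₂) ℕ.⊔ (N₃ ℕ.⊔ N₄) , λ m n N≤m N≤n →
      subst (∣ x m * y m - x n * y n ∣ ≤_) Dη≡δ
        (product-close (x m) (y m) (x n) (y n) B C η 0≤η
          (hB m (⊔₁ {N₁} {N₂} (⊔₁ {N₁ ℕ.⊔ N₂} {N₃ ℕ.⊔ N₄} N≤m)))
          (hC n (⊔₂ {N₁} {N₂} (⊔₁ {N₁ ℕ.⊔ N₂} {N₃ ℕ.⊔ N₄} N≤n)))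
          (hx m n (⊔₁ {N₃} {N₄} (⊔₂ {N₁ ℕ.⊔ N₂} {N₃ ℕ.⊔ N₄} N≤m))
                  (⊔₁ {N₃} {N₄} (⊔₂ {N₁ ℕ.⊔ N₂} {N₃ ℕ.⊔ N₄} N≤n)))
          (hy m n (⊔₂ {N₃} {N₄} (⊔₂ {N₁ ℕ.⊔ N₂} {N₃ ℕ.⊔ N₄} N≤m))
                  (⊔₂ {N₃} {N₄} (⊔₂ {N₁ ℕ.⊔ N₂} {N₃ ℕ.⊔ N₄} N≤n))))
    go : Bound x → Bound y → Close (λ n → x n * y n) δ
    go (B , 0<B , N₁ , hB) (C , 0<C , N₂ , hC) =
      scaled (rescale (B + C) δ (+-pos {B} {C} (<⇒≤ 0<B) 0<C) 0<δ)
      where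
      scaled : (∃[ η ] 0ℚ < η × (B + C) * η ≡ δ) → Close (λ n → x n * y n) δ
      scaled (η , 0<η , Dη≡δ) =
        combine B C η N₁ N₂ (<⇒≤ 0<η) Dη≡δ hB hC (cx η 0<η) (cy η 0<η)

  inverse-close : ∀ a b r s ρ δ → 0ℚ < ρ → 0ℚ ≤ δ → ρ ≤ a → ρ ≤ b →
                  r * a ≡ 1ℚ → s * b ≡ 1ℚ → ∣ b - a ∣ ≤ δ * (ρ * ρ) → ∣ r - s ∣ ≤ δ
  inverse-close a b r s ρ δ 0<ρ 0≤δ ρ≤a ρ≤b ra sb b-a =
    *-cancelʳ-≤-pos (a * b) {{positive 0<ab}} (begin
      ∣ r - s ∣ * (a * b)              ≡⟨ cong (∣ r - s ∣ *_) (sym (0≤p⇒∣p∣≡p (<⇒≤ 0<ab))) ⟩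
      ∣ r - s ∣ * ∣ a * b ∣            ≡⟨ sym (∣p*q∣≡∣p∣*∣q∣ (r - s) (a * b)) ⟩
      ∣ (r - s) * (a * b) ∣            ≡⟨ cong ∣_∣ (clear-recips r s a b) ⟩
      ∣ (r * a) * b - (s * b) * a ∣    ≡⟨ cong₂ (λ u v → ∣ u * b - v * a ∣) ra sb ⟩
      ∣ 1ℚ * b - 1ℚ * a ∣              ≡⟨ cong₂ (λ u v → ∣ u - v ∣) (*-identityˡ b) (*-identityˡ a) ⟩
      ∣ b - a ∣                        ≤⟨ b-a ⟩
      δ * (ρ * ρ)
        ≤⟨ *-monoˡ-≤-nonNeg δ {{nonNegative 0≤δ}}
             (*-mono-≤ {ρ} {a} {ρ} {b} (<⇒≤ 0<ρ) (<⇒≤ 0<b) ρ≤a ρ≤b) ⟩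
      δ * (a * b)                      ∎)
    where
    open ≤-Reasoning
    0<b : 0ℚ < b
    0<b = <-≤-trans 0<ρ ρ≤b
    0<ab : 0ℚ < a * b
    0<ab = *-pos {a} {b} (<-≤-trans 0<ρ ρ≤a) 0<b

  recip-cauchy : ∀ (x : ℝ) → 0ᴿ <ᴿ x → Cauchy (λ n → recip (seq x n))
  recip-cauchy x (ρ , 0<ρ , N₁ , hρ) δ 0<δ
    with cauchy x (δ * (ρ * ρ)) (*-pos {δ} {ρ * ρ} 0<δ (*-pos {ρ} {ρ} 0<ρ 0<ρ))
  ... | N₂ , hx = N₁ ℕ.⊔ N₂ , λ m n N≤m N≤n →
    inverse-close (seq x m) (seq x n) (recip (seq x m)) (recip (seq x n)) ρ δ 0<ρ (<⇒≤ 0<δ)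
      (ρ≤ m (⊔₁ {N₁} {N₂} N≤m)) (ρ≤ n (⊔₁ {N₁} {N₂} N≤n))
      (recip-inverse (seq x m) (<-≤-trans 0<ρ (ρ≤ m (⊔₁ {N₁} {N₂} N≤m))))
      (recip-inverse (seq x n) (<-≤-trans 0<ρ (ρ≤ n (⊔₁ {N₁} {N₂} N≤n))))
      (hx n m (⊔₂ {N₁} {N₂} N≤n) (⊔₂ {N₁} {N₂} N≤m))
    where
    ρ≤ : ∀ n → N₁ ℕ.≤ n → ρ ≤ seq x n
    ρ≤ n N₁≤n = subst (_≤ seq x n) (+-identityˡ ρ) (hρ n N₁≤n)

infixl 7 _*ᴿ_ _/ᴿ_⟨_⟩

_*ᴿ_ : ℝ → ℝ → ℝ
(x *ᴿ y) .seq n = seq x n * seq y n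
(x *ᴿ y) .cauchy = *-cauchy (seq x) (seq y) (cauchy x) (cauchy y)

inverse : (x : ℝ) → 0ᴿ <ᴿ x → ℝ
inverse x 0<x .seq n = recip (seq x n)
inverse x 0<x .cauchy = recip-cauchy x 0<x

_/ᴿ_⟨_⟩ : (x y : ℝ) → 0ᴿ <ᴿ y → ℝ
x /ᴿ y ⟨ 0<y ⟩ = x *ᴿ inverse y 0<y

*ᴿ-pos : ∀ {x y} → 0ᴿ <ᴿ x → 0ᴿ <ᴿ y → 0ᴿ <ᴿ x *ᴿ y
*ᴿ-pos {x} {y} (δ , 0<δ , N , hx) (η , 0<η , M , hy) =
  δ * η , *-pos {δ} {η} 0<δ 0<η , N ℕ.⊔ M , λ n le →
    let δ≤x = subst (_≤ seq x n) (+-identityˡ δ) (hx n (⊔₁ {N} {M} le))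
        η≤y = subst (_≤ seq y n) (+-identityˡ η) (hy n (⊔₂ {N} {M} le))
    in subst (_≤ seq x n * seq y n) (sym (+-identityˡ (δ * η)))
         (*-mono-≤ {δ} {seq x n} {η} {seq y n}
           (<⇒≤ 0<δ) (≤-trans (<⇒≤ 0<η) η≤y) δ≤x η≤y)

fromℕ-pos : ∀ n → 0 ℕ.< n → 0ᴿ <ᴿ fromℕ n
fromℕ-pos (suc n) _ =
  + suc n / 1 , positive⁻¹ (+ suc n / 1) {{normalize-pos (suc n) 1}} , 0 ,
  λ _ _ → ≤-reflexive (+-identityˡ (+ suc n / 1))

-- harmonic a l = Σ_{a < m ≤ a + l} 1 / m
harmonic : ℕ → ℕ → ℚ
harmonic a zero    = 0ℚ
harmonic a (suc l) = + 1 / suc a + harmonic (suc a) l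

frac-≤ : ∀ a b c d → a ℕ.* suc d ℕ.≤ c ℕ.* suc b → + a / suc b ≤ + c / suc d
frac-≤ a b c d h = toℚᵘ-cancel-≤ (ℚᵘₚ.≤-respˡ-≃ (ℚᵘₚ.≃-sym (toℚᵘ-fromℚᵘ (ℚᵘ.mkℚᵘ (+ a) b)))
  (ℚᵘₚ.≤-respʳ-≃ (ℚᵘₚ.≃-sym (toℚᵘ-fromℚᵘ (ℚᵘ.mkℚᵘ (+ c) d)))
    (ℚᵘ.*≤* (subst₂ ℤ._≤_ (ℤₚ.pos-* a (suc d)) (ℤₚ.pos-* c (suc b)) (ℤ.+≤+ h)))))

frac-suc : ∀ a c → + suc a / suc c ≡ + 1 / suc c + + a / suc c
frac-suc a c = toℚᵘ-injective (begin
  toℚᵘ (+ suc a / suc c)             ≈⟨ toℚᵘ-fromℚᵘ (ℚᵘ.mkℚᵘ (+ suc a) c) ⟩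
  ℚᵘ.mkℚᵘ (+ suc a) c                ≈⟨ ℚᵘ.*≡* (trans (cong (λ t → + suc a ℤ.* t) (ℤₚ.pos-* (suc c) (suc c)))
                                          (trans (sym (ℤₚ.*-assoc (+ suc a) (+ suc c) (+ suc c)))
                                            (cong (ℤ._* + suc c) (ℤₚ.*-distribʳ-+ (+ suc c) (+ 1) (+ a))))) ⟩
  ℚᵘ.mkℚᵘ (+ 1) c ℚᵘ.+ ℚᵘ.mkℚᵘ (+ a) c
    ≈⟨ ℚᵘₚ.+-cong (ℚᵘₚ.≃-sym (toℚᵘ-fromℚᵘ (ℚᵘ.mkℚᵘ (+ 1) c))) (ℚᵘₚ.≃-sym (toℚᵘ-fromℚᵘ (ℚᵘ.mkℚᵘ (+ a) c))) ⟩
  toℚᵘ (+ 1 / suc c) ℚᵘ.+ toℚᵘ (+ a / suc c)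
    ≈⟨ ℚᵘₚ.≃-sym (toℚᵘ-homo-+ (+ 1 / suc c) (+ a / suc c)) ⟩
  toℚᵘ (+ 1 / suc c + + a / suc c) ∎)
  where open ℚᵘₚ.≃-Reasoning

frac-zero : ∀ c → + 0 / suc c ≡ 0ℚ
frac-zero c = ≤-antisym (frac-≤ 0 c 0 0 z≤n) (frac-≤ 0 0 0 c z≤n)

harmonic-lower : ∀ b l c → b ℕ.+ l ℕ.≤ suc c → + l / suc c ≤ harmonic b l
harmonic-lower b zero c h = ≤-reflexive (frac-zero c)
harmonic-lower b (suc l) c h = subst (_≤ harmonic b (suc l)) (sym (frac-suc l c))
  (+-mono-≤ (frac-≤ 1 c 1 b (subst₂ ℕ._≤_ (sym (ℕₚ.*-identityˡ (suc b))) (sym (ℕₚ.*-identityˡ (suc c)))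
               (ℕₚ.≤-trans (s≤s (ℕₚ.m≤m+n b l)) h′)))
            (harmonic-lower (suc b) l c h′))
  where h′ : suc b ℕ.+ l ℕ.≤ suc c
        h′ = subst (ℕ._≤ suc c) (ℕₚ.+-suc b l) h

harmonic-upper : ∀ b l c → suc c ℕ.≤ b → harmonic b l ≤ + l / suc c
harmonic-upper b zero c h = ≤-reflexive (sym (frac-zero c))
harmonic-upper b (suc l) c h = subst (harmonic b (suc l) ≤_) (sym (frac-suc l c))
  (+-mono-≤ (frac-≤ 1 b 1 c (subst₂ ℕ._≤_ (sym (ℕₚ.*-identityˡ (suc c))) (sym (ℕₚ.*-identityˡ (suc b)))
               h′))
            (harmonic-upper (suc b) l c h′))
  where h′ : suc c ℕ.≤ suc b
        h′ = ℕₚ.≤-trans h (ℕₚ.n≤1+n b)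

harmonic-++ : ∀ a l l′ → harmonic a (l ℕ.+ l′) ≡ harmonic a l + harmonic (a ℕ.+ l) l′
harmonic-++ a zero l′ = trans (cong (λ t → harmonic t l′) (sym (ℕₚ.+-identityʳ a)))
  (sym (+-identityˡ (harmonic (a ℕ.+ 0) l′)))
harmonic-++ a (suc l) l′ = trans
  (cong (λ t → + 1 / suc a + t) (trans (harmonic-++ (suc a) l l′)
    (cong (λ t → harmonic (suc a) l + harmonic t l′) (sym (ℕₚ.+-suc a l)))))
  (sym (+-assoc (+ 1 / suc a) (harmonic (suc a) l) (harmonic (a ℕ.+ suc l) l′)))

harmonic-block : ∀ a l M → harmonic (a ℕ.* M) (suc l ℕ.* M)
               ≡ harmonic (a ℕ.* M) M + harmonic (suc a ℕ.* M) (l ℕ.* M)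
harmonic-block a l M = trans (harmonic-++ (a ℕ.* M) M (l ℕ.* M))
  (cong (λ t → harmonic (a ℕ.* M) M + harmonic t (l ℕ.* M)) (ℕₚ.+-comm (a ℕ.* M) M))

refine-lower : ∀ a l M → harmonic a l ≤ harmonic (a ℕ.* suc M) (l ℕ.* suc M)
refine-lower a zero M = ≤-refl
refine-lower a (suc l) M = subst (harmonic a (suc l) ≤_) (sym (harmonic-block a l (suc M)))
  (+-mono-≤
    (≤-trans (frac-≤ 1 a (suc M) (M ℕ.+ a ℕ.* suc M)
               (ℕₚ.≤-reflexive (trans (ℕₚ.*-identityˡ _) (ℕₚ.*-comm (suc a) (suc M)))))
             (harmonic-lower (a ℕ.* suc M) (suc M) (M ℕ.+ a ℕ.* suc M)
               (ℕₚ.≤-reflexive (ℕₚ.+-comm (a ℕ.* suc M) (suc M)))))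
    (refine-lower (suc a) l M))

refine-upper : ∀ a l M → harmonic (suc a ℕ.* suc M) (l ℕ.* suc M) + + 1 / suc (a ℕ.+ l)
             ≤ harmonic (suc a) l + + 1 / suc a
refine-upper a zero M =
  ≤-reflexive (cong (λ t → 0ℚ + + 1 / suc t) (ℕₚ.+-identityʳ a))
refine-upper a (suc l) M = begin
  harmonic (suc a ℕ.* suc M) (suc l ℕ.* suc M) + + 1 / suc (a ℕ.+ suc l)
    ≡⟨ cong₂ (λ s t → s + + 1 / suc t) (harmonic-block (suc a) l (suc M)) (ℕₚ.+-suc a l) ⟩
  (X + Y) + Z                  ≡⟨ +-assoc X Y Z ⟩
  X + (Y + Z)                  ≤⟨ +-mono-≤ X≤ (refine-upper (suc a) l M) ⟩
  + 1 / suc a + (H + U)        ≡⟨ rotate (+ 1 / suc a) H U ⟩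
  (U + H) + + 1 / suc a        ∎
  where
  open ≤-Reasoning
  X Y Z H U : ℚ
  X = harmonic (suc a ℕ.* suc M) (suc M)
  Y = harmonic (suc (suc a) ℕ.* suc M) (l ℕ.* suc M)
  Z = + 1 / suc (suc a ℕ.+ l)
  H = harmonic (suc (suc a)) l
  U = + 1 / suc (suc a)
  X≤ : X ≤ + 1 / suc a
  X≤ = ≤-trans (harmonic-upper (suc a ℕ.* suc M) (suc M) (M ℕ.+ a ℕ.* suc M) ℕₚ.≤-refl)
    (frac-≤ (suc M) (M ℕ.+ a ℕ.* suc M) 1 a
      (ℕₚ.≤-reflexive (trans (ℕₚ.*-comm (suc M) (suc a)) (sym (ℕₚ.*-identityˡ _)))))

refine-upper′ : ∀ a l M → harmonic (suc a ℕ.* suc M) (l ℕ.* suc M) ≤ harmonic (suc a) l + + 1 / suc a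
refine-upper′ a l M = ≤-trans
  (subst (_≤ X + + 1 / suc (a ℕ.+ l)) (+-identityʳ X)
    (+-monoʳ-≤ X (frac-≤ 0 0 1 (a ℕ.+ l) z≤n)))
  (refine-upper a l M)
  where X : ℚ
        X = harmonic (suc a ℕ.* suc M) (l ℕ.* suc M)

-- log k = ∫₁ᵏ dt/t as the limit of right-endpoint Riemann sums: with step 1/n,
--   Σ_{1 ≤ i ≤ (k-1)n} (1/n) · 1/(1 + i/n) = Σ_{n < m ≤ kn} 1/m,
-- taken at n = 1, 2, 3, ….  Meaningful for k ≥ 1 (k = 0 gives 0).
logSeq : ℕ → ℕ → ℚ
logSeq k N = harmonic (suc N) ((k ℕ.∸ 1) ℕ.* suc N)

logSeq-close : ∀ k M N → logSeq k M - logSeq k N ≤ + 1 / suc N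
logSeq-close k M N = begin
  L - R                       ≤⟨ +-monoˡ-≤ (- R) L≤ ⟩
  (R + + 1 / suc N) - R       ≡⟨ cancel R (+ 1 / suc N) ⟩
  + 1 / suc N                 ∎
  where
  open ≤-Reasoning
  j : ℕ
  j = k ℕ.∸ 1
  L R : ℚ
  L = logSeq k M
  R = logSeq k N
  swap : j ℕ.* suc M ℕ.* suc N ≡ j ℕ.* suc N ℕ.* suc M
  swap = trans (ℕₚ.*-assoc j (suc M) (suc N))
    (trans (cong (j ℕ.*_) (ℕₚ.*-comm (suc M) (suc N))) (sym (ℕₚ.*-assoc j (suc N) (suc M))))
  L≤ : L ≤ R + + 1 / suc N
  L≤ = ≤-trans (refine-lower (suc M) (j ℕ.* suc M) N)
    (subst₂ (λ s t → harmonic s t ≤ R + + 1 / suc N)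
      (ℕₚ.*-comm (suc N) (suc M)) (sym swap) (refine-upper′ N (j ℕ.* suc N) M))

archimedean : ∀ δ → 0ℚ < δ → ∃[ N ] (∀ n → N ℕ.≤ n → + 1 / suc n ≤ δ)
archimedean δ@(mkℚ +[1+ p ] d _) 0<δ = d , λ n d≤n → subst (+ 1 / suc n ≤_) (↥p/↧p≡p δ)
  (frac-≤ 1 n (suc p) d (ℕₚ.≤-trans
    (subst (ℕ._≤ suc n) (sym (ℕₚ.*-identityˡ (suc d))) (s≤s d≤n)) (ℕₚ.m≤m+n (suc n) _)))
archimedean (mkℚ (+ 0) d _) (*<* (ℤ.+<+ ()))
archimedean (mkℚ ℤ.-[1+ n ] d _) (*<* ())

log : ℕ → ℝ
log k .seq = logSeq k
log k .cauchy δ 0<δ with archimedean δ 0<δ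
... | N , h = N , λ m n N≤m N≤n → ∣∣-bound
  (≤-trans (logSeq-close k m n) (h n N≤n))
  (≤-trans (≤-reflexive (neg-difference (logSeq k m) (logSeq k n)))
    (≤-trans (logSeq-close k n m) (h m N≤m)))

log-pos : ∀ k → 2 ℕ.≤ k → 0ᴿ <ᴿ log k
log-pos (suc (suc j)) (s≤s (s≤s _)) = ½ , *<* (ℤ.+<+ (s≤s z≤n)) , 0 ,
  λ n _ → subst (_≤ logSeq (suc (suc j)) n) (sym (+-identityˡ ½))
    (≤-trans
      (frac-≤ 1 1 (suc j ℕ.* suc n) (n ℕ.+ suc j ℕ.* suc n) (half n))
      (harmonic-lower (suc n) (suc j ℕ.* suc n) (n ℕ.+ suc j ℕ.* suc n) ℕₚ.≤-refl))
  where
  half : ∀ n → 1 ℕ.* suc (n ℕ.+ suc j ℕ.* suc n) ℕ.≤ suc j ℕ.* suc n ℕ.* 2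
  half n = subst₂ ℕ._≤_ (sym (ℕₚ.*-identityˡ _))
    (solve 1 (λ x → x :+ x := x :* con 2) refl (suc j ℕ.* suc n))
    (ℕₚ.+-monoˡ-≤ (suc j ℕ.* suc n) (ℕₚ.m≤m+n (suc n) (j ℕ.* suc n)))
    where open +-*-Solver

k²log-pos : ∀ k → 2 ℕ.≤ k → 0ᴿ <ᴿ fromℕ (k ℕ.^ 2) *ᴿ log k
k²log-pos k@(suc _) 2≤k =
  *ᴿ-pos {fromℕ (k ℕ.^ 2)} {log k} (fromℕ-pos (k ℕ.^ 2) (s≤s z≤n)) (log-pos k 2≤k)

-- The index v : Fin n stands for the vertex toℕ v + 1 of [n] = {1, …, n}.
label : ∀ {n} → Fin n → ℕ
label v = suc (toℕ v)

record Graph (n : ℕ) : Set₁ where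
  field
    Adj     : Rel (Fin n) 0ℓ
    adj?    : Decidable Adj
    adj-sym : Symmetric Adj
    no-loop : ∀ v → ¬ Adj v v

open Graph public

-- Each edge {u , v} is listed once, as the pair with u < v.
edges : ∀ {n} → Graph n → List (Fin n × Fin n)
edges {n} G = filter (λ (u , v) → (u Finₚ.<? v) ×-dec adj? G u v)
                     (cartesianProduct (allFin n) (allFin n))

edgeCount : ∀ {n} → Graph n → ℕ
edgeCount G = length (edges G)

IsAP : ℕ → ∀ {n} → Subset n → Set
IsAP k {n} S = ∃[ a ] ∃[ d ] 1 ℕ.≤ d ×
  (∀ x → (∃[ v ] v ∈ S × label v ≡ x) ⇔ (∃[ i ] i ℕ.< k × x ≡ a ℕ.+ i ℕ.* d))

Independent : ∀ {n} → Graph n → Subset n → Set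
Independent G S = ∀ u v → u ∈ S → v ∈ S → ¬ Adj G u v

{-# OPTIONS --safe #-}

-- Average over progressions a, a + d, …, with d = q r ≤ D ≈ n / 2k, where r has no prime factor below
-- k and d carries the weight Λ(q).  An edge of length m meets such a progression only if m = j q r with
-- j < k; then q determines r, since j r = j′ r′ with j, j′ < k and r, r′ rough forces r = r′.  So the
-- edge is hit with total weight at most k ∑_{q ∣ m} Λ(q) ≤ k log n, while Chebyshev makes the total
-- weight of the differences at least of order T = ∑_r D / r over rough r.
--
-- T is at least of order D max(1, log D / log k): writing c = s r with r rough, all but a small
-- proportion of c ≤ D, weighted by D / c, have s ≤ k^O(1), because the mean of
-- log gcd(c, lcm(1, …, K)) is O(log K) for K = O(k²).  Hence D log D ≲ T ∑_s 1/s ≲ T log k.  If every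
-- progression contained an edge, comparing the two bounds would give e ≳ n² / (k² log k).
--
-- No primes are needed: Λ(q) is the logarithm of lcm(1, …, q) / lcm(1, …, q - 1).
module Submission where

open import Defs
open import Data.Nat
open import Data.Nat.Properties
open import Data.Nat.Divisibility
open import Data.Nat.DivMod using (m≡m%n+[m/n]*n; m%n<n; m/n*n≤m; m/n≤m; m≥n⇒m/n>0; m*n/n≡m;
  /-monoˡ-≤; /-monoʳ-≤; /-congʳ; m/n/o≡m/[n*o]; n/1≡n)
open import Data.Nat.GCD
open import Data.Nat.LCM
open import Data.Nat.Coprimality using (Coprime; coprime-divisor)
open import Data.Nat.Tactic.RingSolver using (solve-∀)
import Data.Integer as ℤ
open import Data.Rational as ℚ using (ℚ; 0ℚ; 1ℚ; ½; nonNegative; positive)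
import Data.Rational.Properties as ℚ
open import Data.Rational.Solver using (module +-*-Solver)
open import Data.Fin using (Fin; toℕ; fromℕ<)
open import Data.Fin.Properties using (toℕ-fromℕ<; toℕ-injective; toℕ<n)
import Data.Fin.Properties as Fin
open import Data.Fin.Subset using (Subset; _∈_)
open import Data.Vec using (tabulate)
open import Data.Vec.Properties using (lookup∘tabulate; lookup⇒[]=; []=⇒lookup)
open import Data.List using (List; []; _∷_; length; allFin; cartesianProduct)
import Data.List.Membership.Propositional as List
open import Data.List.Membership.Propositional.Properties using (∈-filter⁺; ∈-filter⁻; ∈-cartesianProduct⁺; ∈-allFin)
open import Data.List.Relation.Unary.Any using (here; there)
open import Data.Product using (∃-syntax; _×_; _,_; proj₁; proj₂)
open import Data.Sum using (inj₁; inj₂)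
open import Function.Bundles using (mk⇔)
open import Relation.Binary using (tri<; tri≈; tri>)
open import Relation.Binary.PropositionalEquality
open import Relation.Nullary
open import Relation.Nullary.Decidable using (_×-dec_; ¬?; does; dec-true)
open import Relation.Unary using (Pred) renaming (Decidable to Decidable₁)

-- Finite sums and indicators

∑ : ℕ → (ℕ → ℕ) → ℕ
∑ zero    f = 0
∑ (suc n) f = ∑ n f + f n

∑-cong : ∀ n {f g} → (∀ i → f i ≡ g i) → ∑ n f ≡ ∑ n g
∑-cong zero    h = refl
∑-cong (suc n) h = cong₂ _+_ (∑-cong n h) (h n)

∑-mono : ∀ n {f g} → (∀ i → i < n → f i ≤ g i) → ∑ n f ≤ ∑ n g
∑-mono zero    h = z≤n
∑-mono (suc n) h = +-mono-≤ (∑-mono n λ i i<n → h i (m<n⇒m<1+n i<n)) (h n ≤-refl)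

∑-monoˡ : ∀ {m n} f → m ≤ n → ∑ m f ≤ ∑ n f
∑-monoˡ {n = zero}  f z≤n = z≤n
∑-monoˡ {n = suc n} f m≤1+n with m≤n⇒m<n∨m≡n m≤1+n
... | inj₁ (s≤s m≤n) = ≤-trans (∑-monoˡ f m≤n) (m≤m+n _ _)
... | inj₂ refl = ≤-refl

∑-+ : ∀ n f g → ∑ n (λ i → f i + g i) ≡ ∑ n f + ∑ n g
∑-+ zero    f g = refl
∑-+ (suc n) f g = trans (cong (_+ (f n + g n)) (∑-+ n f g)) (lemma (∑ n f) (∑ n g) (f n) (g n))
  where lemma : ∀ a b c d → (a + b) + (c + d) ≡ (a + c) + (b + d)
        lemma = solve-∀

∑-* : ∀ c n f → ∑ n (λ i → c * f i) ≡ c * ∑ n f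
∑-* c zero    f = sym (*-zeroʳ c)
∑-* c (suc n) f = trans (cong (_+ c * f n) (∑-* c n f)) (sym (*-distribˡ-+ c (∑ n f) (f n)))

∑-const : ∀ n c → ∑ n (λ _ → c) ≡ n * c
∑-const zero    c = refl
∑-const (suc n) c = trans (cong (_+ c) (∑-const n c)) (+-comm (n * c) c)

∑-zero : ∀ n → ∑ n (λ _ → 0) ≡ 0
∑-zero n = trans (∑-const n 0) (*-zeroʳ n)

∑-swap : ∀ m n (f : ℕ → ℕ → ℕ) → ∑ m (λ i → ∑ n (f i)) ≡ ∑ n (λ j → ∑ m (λ i → f i j))
∑-swap zero    n f = sym (∑-zero n)
∑-swap (suc m) n f = trans (cong (_+ ∑ n (f m)) (∑-swap m n f)) (sym (∑-+ n (λ j → ∑ m (λ i → f i j)) (f m)))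

term≤∑ : ∀ {n i} f → i < n → f i ≤ ∑ n f
term≤∑ {i = i} f i<n = ≤-trans (m≤n+m (f i) (∑ i f)) (∑-monoˡ f i<n)

∑-split : ∀ m n f → ∑ (m + n) f ≡ ∑ m f + ∑ n (λ i → f (m + i))
∑-split m zero    f = trans (cong (λ t → ∑ t f) (+-identityʳ m)) (sym (+-identityʳ _))
∑-split m (suc n) f = trans (cong (λ t → ∑ t f) (+-suc m n))
  (trans (cong (_+ f (m + n)) (∑-split m n f)) (+-assoc (∑ m f) _ _))

⟦_⟧ : ∀ {p} {P : Set p} → Dec P → ℕ
⟦ yes _ ⟧ = 1
⟦ no  _ ⟧ = 0

module _ {p} {P : Set p} where
  ⟦⟧≤1 : (d : Dec P) → ⟦ d ⟧ ≤ 1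
  ⟦⟧≤1 (yes _) = ≤-refl
  ⟦⟧≤1 (no  _) = z≤n

  ⟦⟧-true : (d : Dec P) → P → ⟦ d ⟧ ≡ 1
  ⟦⟧-true (yes _) _ = refl
  ⟦⟧-true (no ¬p) p = contradiction p ¬p

  ⟦⟧*-≤ : (d : Dec P) {m n : ℕ} → (P → m ≤ n) → ⟦ d ⟧ * m ≤ n
  ⟦⟧*-≤ (yes p) {m} h = ≤-trans (≤-reflexive (+-identityʳ m)) (h p)
  ⟦⟧*-≤ (no _)  h = z≤n

∑-unique : ∀ n {p} {P : Pred ℕ p} (P? : Decidable₁ P) → (∀ {i j} → P i → P j → i ≡ j) →
           ∑ n (λ i → ⟦ P? i ⟧) ≤ 1
∑-unique zero    P? uniq = z≤n
∑-unique (suc n) P? uniq with P? n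
... | no  _  = ≤-trans (≤-reflexive (+-identityʳ _)) (∑-unique n P? uniq)
... | yes pn = ≤-reflexive (cong (_+ 1) (n≤0⇒n≡0 (≤-trans (∑-mono n none) (≤-reflexive (∑-zero n)))))
  where
  none : ∀ i → i < n → ⟦ P? i ⟧ ≤ 0
  none i i<n with P? i
  ... | yes pi = contradiction (uniq pi pn) (<⇒≢ i<n)
  ... | no  _  = z≤n

-- Binary logarithms

2^-pos : ∀ n → 0 < 2 ^ n
2^-pos n = m^n>0 2 n

lg-bracket : ∀ n → ∃[ l ] 2 ^ l ≤ suc n × suc n < 2 ^ suc l
lg-bracket zero    = 0 , ≤-refl , ≤-refl
lg-bracket (suc n) with lg-bracket n
... | l , lo , hi with suc (suc n) <? 2 ^ suc l
...   | yes lt = l , m≤n⇒m≤1+n lo , lt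
...   | no  ge = suc l , ≮⇒≥ ge , <-≤-trans (s≤s hi) (≤-trans (+-monoˡ-≤ _ (2^-pos (suc l)))
          (≤-reflexive (cong (2 ^ suc l +_) (sym (+-identityʳ (2 ^ suc l))))))

lg : ℕ → ℕ
lg zero    = 0
lg (suc n) = proj₁ (lg-bracket n)

2^lg≤ : ∀ n → 0 < n → 2 ^ lg n ≤ n
2^lg≤ (suc n) _ = proj₁ (proj₂ (lg-bracket n))

<2^1+lg : ∀ n → n < 2 ^ suc (lg n)
<2^1+lg zero    = s≤s z≤n
<2^1+lg (suc n) = proj₂ (proj₂ (lg-bracket n))

2^-cancel-< : ∀ {m n} → 2 ^ m < 2 ^ n → m < n
2^-cancel-< {m} {n} h with m <? n
... | yes m<n = m<n
... | no  m≮n = contradiction h (≤⇒≯ (^-monoʳ-≤ 2 (≮⇒≥ m≮n)))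

2^-cancel-≤ : ∀ {m n} → 2 ^ m ≤ 2 ^ n → m ≤ n
2^-cancel-≤ {m} {n} h = ≤-pred (2^-cancel-< (≤-<-trans h (^-monoʳ-< 2 (s≤s (s≤s z≤n)) (n<1+n n))))

-- Growth of lcm(1, …, n)

L : ℕ → ℕ
L zero    = 1
L (suc n) = lcm (suc n) (L n)

gcd>0 : ∀ i m → 0 < gcd (suc i) m
gcd>0 i m = n≢0⇒n>0 (gcd[m,n]≢0 (suc i) m (inj₁ λ ()))

-- Follows from `gcd * lcm = product` after cancelling the gcd. The cofactor `c` is a variable
-- because the lemma is applied to `L`, to `lcmDivisors` and to `gcd n (L i)`.
lcm-step : ∀ i m c → suc i ≡ c * gcd (suc i) m → lcm (suc i) m ≡ c * m
lcm-step i m c eq = *-cancelˡ-≡ _ _ (gcd (suc i) m) {{>-nonZero (gcd>0 i m)}}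
  (begin
    gcd (suc i) m * lcm (suc i) m  ≡⟨ gcd*lcm (suc i) m ⟩
    suc i * m                      ≡⟨ cong (_* m) eq ⟩
    c * gcd (suc i) m * m          ≡⟨ lemma c (gcd (suc i) m) m ⟩
    gcd (suc i) m * (c * m)        ∎)
  where
  open ≡-Reasoning
  lemma : ∀ a b d → a * b * d ≡ b * (a * d)
  lemma = solve-∀

abstract
  -- The ratio `L (suc i) / L i`, that is, the exponential of the von Mangoldt function at `suc i`.
  -- It is abstract so that only `growth-eq` is seen and the quotient never unfolds.
  growth : ℕ → ℕ
  growth i = quotient (gcd[m,n]∣m (suc i) (L i))

  growth-eq : ∀ i → suc i ≡ growth i * gcd (suc i) (L i)
  growth-eq i = m∣n⇒n≡quotient*m (gcd[m,n]∣m (suc i) (L i))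

L-suc : ∀ i → L (suc i) ≡ growth i * L i
L-suc i = lcm-step i (L i) (growth i) (growth-eq i)

growth>0 : ∀ i → 0 < growth i
growth>0 i with growth i in eq
... | suc _ = s≤s z≤n
... | zero = contradiction (trans (growth-eq i) (cong (_* gcd (suc i) (L i)) eq)) λ ()

L>0 : ∀ n → 0 < L n
L>0 zero    = s≤s z≤n
L>0 (suc n) = subst (0 <_) (sym (L-suc n)) (*-mono-< (growth>0 n) (L>0 n))

∣L : ∀ {i n} → suc i ≤ n → suc i ∣ L n
∣L {i} {suc n} (s≤s i≤n) with m≤n⇒m<n∨m≡n i≤n
... | inj₁ i<n  = ∣-trans (∣L i<n) (n∣lcm[m,n] (suc n) (L n))
... | inj₂ refl = m∣lcm[m,n] (suc n) (L n)

≤⇒∣L : ∀ {m n} → 0 < m → m ≤ n → m ∣ L n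
≤⇒∣L (s≤s _) m≤n = ∣L m≤n

-- Λ i stands for the von Mangoldt function at suc i, as an integer logarithm to base 2.
Λ : ℕ → ℕ
Λ i = lg (growth i)

-- For `g ≥ 2` the logarithm is at least 1, so doubling it absorbs the rounding; `g = 1` is exact.
-- With no additive error, the bound can be multiplied over all factors of `L n`.
≤4^lg : ∀ g → 0 < g → g ≤ 2 ^ (2 * lg g)
≤4^lg g g>0 with lg g | 2^lg≤ g g>0 | <2^1+lg g
... | zero  | _ | lt = ≤-pred lt
... | suc l | _ | lt = <⇒≤ (<-≤-trans lt (^-monoʳ-≤ 2 (≤-trans (s≤s (s≤s (m≤m+n l l))) (≤-reflexive (lemma l)))))
  where lemma : ∀ l → suc (suc (l + l)) ≡ 2 * suc l
        lemma = solve-∀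

growth≤ : ∀ i → growth i ≤ 2 ^ (2 * Λ i)
growth≤ i = ≤4^lg (growth i) (growth>0 i)

2^Λ≤growth : ∀ i → 2 ^ Λ i ≤ growth i
2^Λ≤growth i = 2^lg≤ (growth i) (growth>0 i)

L≤ : ∀ n → L n ≤ 2 ^ (2 * ∑ n Λ)
L≤ zero    = ≤-refl
L≤ (suc n) = begin
  L (suc n)                       ≡⟨ L-suc n ⟩
  growth n * L n                  ≤⟨ *-mono-≤ (growth≤ n) (L≤ n) ⟩
  2 ^ (2 * Λ n) * 2 ^ (2 * ∑ n Λ) ≡⟨ sym (^-distribˡ-+-* 2 (2 * Λ n) _) ⟩
  2 ^ (2 * Λ n + 2 * ∑ n Λ)       ≡⟨ cong (2 ^_) (lemma (Λ n) (∑ n Λ)) ⟩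
  2 ^ (2 * (∑ n Λ + Λ n))         ∎
  where
  open ≤-Reasoning
  lemma : ∀ a b → 2 * a + 2 * b ≡ 2 * (b + a)
  lemma = solve-∀

-- Divisor sums of `Λ`, in place of the identity that they add up to the logarithm

-- The recursion of `L` with the non-divisors of `t` skipped, so that each step can be compared with
-- `growth`.
lcmDivisors : ℕ → ℕ → ℕ
lcmDivisors t zero = 1
lcmDivisors t (suc i) with suc i ∣? t
... | yes _ = lcm (suc i) (lcmDivisors t i)
... | no  _ = lcmDivisors t i

lcmDivisors∣ : ∀ t n → lcmDivisors t n ∣ t
lcmDivisors∣ t zero = 1∣ t
lcmDivisors∣ t (suc i) with suc i ∣? t
... | yes d = lcm-least d (lcmDivisors∣ t i)
... | no  _ = lcmDivisors∣ t i

lcmDivisors∣L : ∀ t n → lcmDivisors t n ∣ L n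
lcmDivisors∣L t zero = ∣-refl
lcmDivisors∣L t (suc i) with suc i ∣? t
... | yes d = lcm-least (m∣lcm[m,n] (suc i) (L i)) (∣-trans (lcmDivisors∣L t i) (n∣lcm[m,n] (suc i) (L i)))
... | no  _ = ∣-trans (lcmDivisors∣L t i) (n∣lcm[m,n] (suc i) (L i))

ΛDivisors : ℕ → ℕ → ℕ
ΛDivisors t n = ∑ n (λ i → ⟦ suc i ∣? t ⟧ * Λ i)

-- The lcm over divisors of `t` divides `L i`, so it has a smaller gcd with `suc i`; adjoining
-- `suc i` therefore multiplies it by at least `growth i`.
2^ΛDivisors≤lcm : ∀ t n → 2 ^ ΛDivisors t n ≤ lcmDivisors t n
2^ΛDivisors≤lcm t zero = ≤-refl
2^ΛDivisors≤lcm t (suc i) with suc i ∣? t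
... | no  _ = subst (λ s → 2 ^ s ≤ lcmDivisors t i) (sym (+-identityʳ (ΛDivisors t i))) (2^ΛDivisors≤lcm t i)
... | yes _ = begin
  2 ^ (ΛDivisors t i + (Λ i + 0))  ≡⟨ cong (2 ^_) (trans (cong (ΛDivisors t i +_) (+-identityʳ (Λ i))) (+-comm _ (Λ i))) ⟩
  2 ^ (Λ i + ΛDivisors t i)        ≡⟨ ^-distribˡ-+-* 2 (Λ i) _ ⟩
  2 ^ Λ i * 2 ^ ΛDivisors t i      ≤⟨ *-mono-≤ (≤-trans (2^Λ≤growth i) growth≤c) (2^ΛDivisors≤lcm t i) ⟩
  c * M                            ≡⟨ sym (lcm-step i M c c-eq) ⟩
  lcm (suc i) M                    ∎
  where
  open ≤-Reasoning
  M = lcmDivisors t i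
  c = quotient (gcd[m,n]∣m (suc i) M)
  c-eq : suc i ≡ c * gcd (suc i) M
  c-eq = m∣n⇒n≡quotient*m (gcd[m,n]∣m (suc i) M)
  instance
    _ = >-nonZero (gcd>0 i (L i))
    _ = >-nonZero (gcd>0 i M)
  gcd≤ : gcd (suc i) M ≤ gcd (suc i) (L i)
  gcd≤ = ∣⇒≤ (gcd-greatest (gcd[m,n]∣m (suc i) M) (∣-trans (gcd[m,n]∣n (suc i) M) (lcmDivisors∣L t i)))
  growth≤c : growth i ≤ c
  growth≤c = *-cancelʳ-≤ (growth i) c (gcd (suc i) (L i)) (begin
    growth i * gcd (suc i) (L i)  ≡⟨ sym (growth-eq i) ⟩
    suc i                         ≡⟨ c-eq ⟩
    c * gcd (suc i) M             ≤⟨ *-monoʳ-≤ c gcd≤ ⟩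
    c * gcd (suc i) (L i)         ∎)

2^ΛDivisors≤ : ∀ t n → 0 < t → 2 ^ ΛDivisors t n ≤ t
2^ΛDivisors≤ t n t>0 = ≤-trans (2^ΛDivisors≤lcm t n) (∣⇒≤ {{>-nonZero t>0}} (lcmDivisors∣ t n))

properDivisor∣L : ∀ {d i} → d ∣ suc i → d ≢ suc i → d ∣ L i
properDivisor∣L {zero}  0∣q d≢q = contradiction (0∣⇒≡0 0∣q) λ ()
properDivisor∣L {suc d} d∣q d≢q = ∣L (≤-pred (≤∧≢⇒< (∣⇒≤ d∣q) d≢q))

-- An instance of the distributivity of gcd over lcm. With `γ = gcd α β` it suffices that `x * γ`
-- divides `α * β`, since `γ * lcm α β = α * β`. This is reached by writing `α * b` as the gcd of
-- `b * x` and `b * a`, then `α * β` as the gcd of `α * x` and `α * b`.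
∣lcm-gcd : ∀ x a b → 0 < x → x ∣ lcm a b → x ∣ lcm (gcd x a) (gcd x b)
∣lcm-gcd x@(suc x′) a b _ x∣ = *-cancelʳ-∣ γ {{>-nonZero γ>0}} (subst (x * γ ∣_) (trans (sym (gcd*lcm α β)) (*-comm γ _)) xγ∣αβ)
  where
  α = gcd x a
  β = gcd x b
  γ = gcd α β
  γ>0 : 0 < γ
  γ>0 = n≢0⇒n>0 (gcd[m,n]≢0 α β (inj₁ (n>0⇒n≢0 (gcd>0 x′ a))))
  γ∣α : γ ∣ α
  γ∣α = gcd[m,n]∣m α β
  γ∣β : γ ∣ β
  γ∣β = gcd[m,n]∣n α β
  γ∣ab : γ ∣ gcd a b
  γ∣ab = gcd-greatest (∣-trans γ∣α (gcd[m,n]∣n x a)) (∣-trans γ∣β (gcd[m,n]∣n x b))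
  xγ∣ab : x * γ ∣ a * b
  xγ∣ab = subst (x * γ ∣_) (trans (*-comm (lcm a b) _) (gcd*lcm a b)) (*-pres-∣ x∣ γ∣ab)
  xγ∣αb : x * γ ∣ α * b
  xγ∣αb = subst (x * γ ∣_) (trans (sym (c*gcd[m,n]≡gcd[cm,cn] b x a)) (*-comm b α))
    (gcd-greatest (subst (x * γ ∣_) (*-comm x b) (*-monoʳ-∣ x (∣-trans γ∣β (gcd[m,n]∣n x b))))
                  (subst (x * γ ∣_) (*-comm a b) xγ∣ab))
  xγ∣αβ : x * γ ∣ α * β
  xγ∣αβ = subst (x * γ ∣_) (sym (c*gcd[m,n]≡gcd[cm,cn] α x b))
    (gcd-greatest (subst (x * γ ∣_) (*-comm x α) (*-monoʳ-∣ x γ∣α)) xγ∣αb)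

-- The converse direction to `2^ΛDivisors≤`: a large smooth part of `n` forces a large divisor sum,
-- whose mean can then be bounded. Passing from `L i` to `L (suc i)` changes the gcd only if `suc i`
-- divides `n`, and then by a factor of at most `growth i`.
gcd-L≤ : ∀ n K → 0 < n → gcd n (L K) ≤ 2 ^ (2 * ΛDivisors n K)
gcd-L≤ n zero n>0 = ∣⇒≤ (gcd[m,n]∣n n 1)
gcd-L≤ n@(suc n′) (suc i) n>0 with suc i ∣? n
... | no q∤n = ≤-trans (∣⇒≤ {{>-nonZero (gcd>0 n′ (L i))}} (gcd-greatest (gcd[m,n]∣m n (L (suc i))) x∣L))
                 (subst (λ s → gcd n (L i) ≤ 2 ^ (2 * s)) (sym (+-identityʳ (ΛDivisors n i))) (gcd-L≤ n i n>0))
  where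
  q = suc i
  x = gcd n (L q)
  -- As `x` divides `n` and `q` does not, `gcd x q` is a proper divisor of `q` and already divides
  -- `L i`.
  d∣L : gcd x q ∣ L i
  d∣L = properDivisor∣L (gcd[m,n]∣n x q)
    λ eq → q∤n (∣-trans (subst (_∣ x) eq (gcd[m,n]∣m x q)) (gcd[m,n]∣m n (L q)))
  x∣L : x ∣ L i
  x∣L = ∣-trans (∣lcm-gcd x q (L i) (gcd>0 n′ (L q)) (gcd[m,n]∣n n (L q))) (lcm-least d∣L (gcd[m,n]∣n x (L i)))
... | yes q∣n = begin
  x                                    ≤⟨ ∣⇒≤ {{lcm≢0}} x∣ ⟩
  lcm q s                              ≡⟨ lcm-step i s (growth i) (trans (growth-eq i) (cong (growth i *_) gcd-eq)) ⟩
  growth i * s                         ≤⟨ *-mono-≤ (growth≤ i) (gcd-L≤ n i n>0) ⟩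
  2 ^ (2 * Λ i) * 2 ^ (2 * ΛDivisors n i) ≡⟨ sym (^-distribˡ-+-* 2 (2 * Λ i) _) ⟩
  2 ^ (2 * Λ i + 2 * ΛDivisors n i)    ≡⟨ cong (2 ^_) (lemma (Λ i) (ΛDivisors n i)) ⟩
  2 ^ (2 * (ΛDivisors n i + (Λ i + 0))) ∎
  where
  open ≤-Reasoning
  q = suc i
  x = gcd n (L q)
  s = gcd n (L i)
  -- Since `q` divides `n`, replacing `L i` by `gcd n (L i)` does not change its gcd with `q`; hence
  -- adjoining `q` to `s` also costs exactly `growth i`.
  gcd-eq : gcd q (L i) ≡ gcd q s
  gcd-eq = ∣-antisym
    (gcd-greatest (gcd[m,n]∣m q (L i)) (gcd-greatest (∣-trans (gcd[m,n]∣m q (L i)) q∣n) (gcd[m,n]∣n q (L i))))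
    (gcd-greatest (gcd[m,n]∣m q s) (∣-trans (gcd[m,n]∣n q s) (gcd[m,n]∣n n (L i))))
  x∣ : x ∣ lcm q s
  x∣ = ∣-trans (∣lcm-gcd x q (L i) (gcd>0 n′ (L q)) (gcd[m,n]∣n n (L q)))
    (lcm-least (∣-trans (gcd[m,n]∣n x q) (m∣lcm[m,n] q s))
      (∣-trans (gcd-greatest (∣-trans (gcd[m,n]∣m x (L i)) (gcd[m,n]∣m n (L q))) (gcd[m,n]∣n x (L i))) (n∣lcm[m,n] q s)))
  lcm≢0 : NonZero (lcm q s)
  lcm≢0 = >-nonZero (subst (0 <_) (sym (lcm-step i s (growth i) (trans (growth-eq i) (cong (growth i *_) gcd-eq))))
    (*-mono-< (growth>0 i) (gcd>0 n′ (L i))))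
  lemma : ∀ a b → 2 * a + 2 * b ≡ 2 * (b + (a + 0))
  lemma = solve-∀

-- Chebyshev's lower bound, by way of the Leibniz triangle

-- The binomial coefficient of `m + t` over `m`, as a count of lattice paths; this form is symmetric
-- and avoids subtraction.
lattice : ℕ → ℕ → ℕ
lattice zero    t       = 1
lattice (suc m) zero    = 1
lattice (suc m) (suc t) = lattice m (suc t) + lattice (suc m) t

lattice-monoʳ : ∀ m t → lattice m t ≤ lattice m (suc t)
lattice-monoʳ zero    t = ≤-refl
lattice-monoʳ (suc m) t = m≤n+m _ (lattice m (suc t))

lattice-monoˡ : ∀ m t → lattice m t ≤ lattice (suc m) t
lattice-monoˡ zero    zero    = ≤-refl
lattice-monoˡ (suc m) zero    = ≤-refl
lattice-monoˡ m       (suc t) = m≤m+n _ _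

2^≤lattice : ∀ m → 2 ^ m ≤ lattice m m
2^≤lattice zero    = ≤-refl
2^≤lattice (suc m) = +-mono-≤ (≤-trans (2^≤lattice m) (lattice-monoʳ m m))
  (≤-trans (≤-reflexive (+-identityʳ (2 ^ m))) (≤-trans (2^≤lattice m) (lattice-monoˡ m m)))

-- The absorption identities in both directions. They share a right-hand side and are proved
-- together, because the step for either one trades a term of one kind for a term of the other.
lattice-absorb : ∀ m t → suc m * lattice (suc m) t ≡ suc (m + t) * lattice m t
                       × suc t * lattice m (suc t) ≡ suc (m + t) * lattice m t
lattice-absorb zero zero = refl , refl
lattice-absorb (suc m) zero with lattice-absorb m zero
... | A , B = cong (λ t → suc t * 1) (cong suc (sym (+-identityʳ m))) , (begin
  1 * (lattice m 1 + 1)      ≡⟨ lemma₁ (lattice m 1) ⟩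
  1 * lattice m 1 + 1        ≡⟨ cong (_+ 1) B ⟩
  suc (m + 0) * lattice m 0 + 1 ≡⟨ cong (_+ 1) (sym A) ⟩
  suc m * 1 + 1              ≡⟨ lemma₂ m ⟩
  suc (suc (m + 0)) * 1      ∎)
  where
  open ≡-Reasoning
  lemma₁ : ∀ a → 1 * (a + 1) ≡ 1 * a + 1
  lemma₁ = solve-∀
  lemma₂ : ∀ a → suc a * 1 + 1 ≡ suc (suc (a + 0)) * 1
  lemma₂ = solve-∀
lattice-absorb zero (suc t) with lattice-absorb zero t
... | A , B = (begin
  1 * (1 + lattice 1 t)   ≡⟨ lemma₁ (lattice 1 t) ⟩
  1 + 1 * lattice 1 t     ≡⟨ cong suc A ⟩
  1 + suc t * 1           ≡⟨ lemma₂ t ⟩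
  suc (suc t) * 1         ∎) , refl
  where
  open ≡-Reasoning
  lemma₁ : ∀ a → 1 * (1 + a) ≡ 1 + 1 * a
  lemma₁ = solve-∀
  lemma₂ : ∀ a → 1 + suc a * 1 ≡ suc (suc a) * 1
  lemma₂ = solve-∀
lattice-absorb (suc m) (suc t) = (begin
    suc (suc m) * (x + lattice (2 + m) t)  ≡⟨ lemma₀ (suc (suc m)) x (lattice (2 + m) t) ⟩
    suc (suc m) * x + suc (suc m) * lattice (2 + m) t
      ≡⟨ cong (suc (suc m) * x +_) (trans (proj₁ (lattice-absorb (suc m) t)) (sym (proj₂ (lattice-absorb (suc m) t)))) ⟩
    suc (suc m) * x + suc t * x            ≡⟨ lemma₁ m t x ⟩
    suc (suc m + suc t) * x                ∎) , (begin
    suc (suc t) * (lattice m (2 + t) + x)  ≡⟨ lemma₀ (suc (suc t)) (lattice m (2 + t)) x ⟩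
    suc (suc t) * lattice m (2 + t) + suc (suc t) * x
      ≡⟨ cong (_+ suc (suc t) * x) (trans (proj₂ (lattice-absorb m (suc t))) (sym (proj₁ (lattice-absorb m (suc t))))) ⟩
    suc m * x + suc (suc t) * x            ≡⟨ lemma₂ m t x ⟩
    suc (suc m + suc t) * x                ∎)
  where
  open ≡-Reasoning
  x = lattice (suc m) (suc t)
  lemma₀ : ∀ a b c → a * (b + c) ≡ a * b + a * c
  lemma₀ = solve-∀
  lemma₁ : ∀ m t x → suc (suc m) * x + suc t * x ≡ suc (suc m + suc t) * x
  lemma₁ = solve-∀
  lemma₂ : ∀ m t x → suc m * x + suc (suc t) * x ≡ suc (suc m + suc t) * x
  lemma₂ = solve-∀

-- 1 / leibniz m t = ∫₀¹ xᵗ (1 - x)ᵐ dx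
leibniz : ℕ → ℕ → ℕ
leibniz m t = suc (m + t) * lattice m t

leibniz-sucˡ : ∀ m t → suc m * leibniz (suc m) t ≡ (2 + (m + t)) * leibniz m t
leibniz-sucˡ m t = trans (lemma (suc m) (2 + (m + t)) (lattice (suc m) t))
  (cong ((2 + (m + t)) *_) (proj₁ (lattice-absorb m t)))
  where lemma : ∀ a b c → a * (b * c) ≡ b * (a * c)
        lemma = solve-∀

leibniz-sucʳ : ∀ m t → suc t * leibniz m (suc t) ≡ (2 + (m + t)) * leibniz m t
leibniz-sucʳ m t = trans (cong (λ s → suc t * (suc s * lattice m (suc t))) (+-suc m t))
  (trans (lemma (suc t) (2 + (m + t)) (lattice m (suc t)))
    (cong ((2 + (m + t)) *_) (proj₂ (lattice-absorb m t))))
  where lemma : ∀ a b c → a * (b * c) ≡ b * (a * c)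
        lemma = solve-∀

-- 1 / leibniz (suc m) t = 1 / leibniz m t - 1 / leibniz m (suc t), so L N / leibniz m t stays integral.
leibniz∣L : ∀ m t {N} → m + t < N → leibniz m t ∣ L N
leibniz∣L zero    t {N} t<N = subst (_∣ L N) (sym (*-identityʳ (suc t))) (∣L t<N)
leibniz∣L (suc m) t {N} lt = *-cancelˡ-∣ (suc m) (∣m+n∣m⇒∣n all part)
  where
  part : suc m * leibniz (suc m) t ∣ suc t * L N
  part = subst (_∣ suc t * L N) (trans (leibniz-sucʳ m t) (sym (leibniz-sucˡ m t)))
    (*-monoʳ-∣ (suc t) (leibniz∣L m (suc t) (subst (_< N) (sym (+-suc m t)) lt)))
  all : suc m * leibniz (suc m) t ∣ suc t * L N + suc m * L N
  all = subst₂ _∣_ (sym (leibniz-sucˡ m t)) (lemma m t (L N))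
    (*-monoʳ-∣ (2 + (m + t)) (leibniz∣L m t (<-trans (n<1+n (m + t)) lt)))
    where lemma : ∀ m t x → (2 + (m + t)) * x ≡ suc t * x + suc m * x
          lemma = solve-∀

-- Nair's argument: `L n` is a multiple of `leibniz m m`, which exceeds the central binomial
-- coefficient.
m≤2∑Λ : ∀ m {n} → m + m < n → m ≤ 2 * ∑ n Λ
m≤2∑Λ m {n} lt = 2^-cancel-≤ (begin
  2 ^ m            ≤⟨ 2^≤lattice m ⟩
  lattice m m      ≤⟨ m≤n*m (lattice m m) (suc (m + m)) ⟩
  leibniz m m      ≤⟨ ∣⇒≤ {{>-nonZero (L>0 n)}} (leibniz∣L m m lt) ⟩
  L n              ≤⟨ L≤ n ⟩
  2 ^ (2 * ∑ n Λ)  ∎)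
  where open ≤-Reasoning

-- The extra unit at 1 makes the lower bound n ≤ 4 ∑ n Λ⁺ hold without exception.
Λ⁺ : ℕ → ℕ
Λ⁺ zero    = suc (Λ 0)
Λ⁺ (suc i) = Λ (suc i)

∑Λ⁺ : ∀ n (w : ℕ → ℕ) → w 0 ≤ 1 → ∑ n (λ i → w i * Λ⁺ i) ≤ suc (∑ n (λ i → w i * Λ i))
∑Λ⁺ zero          w w≤1 = z≤n
∑Λ⁺ (suc zero)    w w≤1 = ≤-trans (≤-reflexive (*-suc (w 0) (Λ 0))) (+-monoˡ-≤ _ w≤1)
∑Λ⁺ (suc (suc n)) w w≤1 = +-monoˡ-≤ _ (∑Λ⁺ (suc n) w w≤1)

half-of : ∀ n → ∃[ m ] m + m < suc n × suc n ≤ 2 + (m + m)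
half-of zero = 0 , s≤s z≤n , s≤s z≤n
half-of (suc zero) = 0 , s≤s z≤n , s≤s (s≤s z≤n)
half-of (suc (suc n)) with half-of n
... | m , lo , hi = suc m , subst (_< 3 + n) (sym (cong suc (+-suc m m))) (s≤s (s≤s lo))
  , subst (λ t → 3 + n ≤ 3 + t) (sym (+-suc m m)) (s≤s (s≤s hi))

∑Λ<∑Λ⁺ : ∀ n → suc (∑ (suc n) Λ) ≤ ∑ (suc n) Λ⁺
∑Λ<∑Λ⁺ zero    = ≤-refl
∑Λ<∑Λ⁺ (suc n) = +-monoˡ-≤ _ (∑Λ<∑Λ⁺ n)

chebyshev : ∀ n → n ≤ 4 * ∑ n Λ⁺
chebyshev zero = z≤n
chebyshev (suc n) with half-of n
... | m , lo , hi = begin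
  suc n                    ≤⟨ hi ⟩
  2 + (m + m)              ≤⟨ s≤s (s≤s (+-mono-≤ (m≤2∑Λ m lo) (m≤2∑Λ m lo))) ⟩
  2 + (2 * S + 2 * S)      ≤⟨ s≤s (s≤s (m≤n+m (2 * S + 2 * S) 2)) ⟩
  4 + (2 * S + 2 * S)      ≡⟨ lemma S ⟩
  4 * suc S                ≤⟨ *-monoʳ-≤ 4 (∑Λ<∑Λ⁺ n) ⟩
  4 * ∑ (suc n) Λ⁺         ∎
  where
  open ≤-Reasoning
  S = ∑ (suc n) Λ
  lemma : ∀ s → 4 + (2 * s + 2 * s) ≡ 4 * suc s
  lemma = solve-∀

-- Rough numbers

SmallFactor : ℕ → ℕ → Set
SmallFactor k r = ∃[ p ] p < k × 2 ≤ p × p ∣ r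

smallFactor? : ∀ k r → Dec (SmallFactor k r)
smallFactor? k r = anyUpTo? (λ p → 2 ≤? p ×-dec p ∣? r) k

Rough : ℕ → ℕ → Set
Rough k r = ¬ SmallFactor k r

rough? : ∀ k r → Dec (Rough k r)
rough? k r = ¬? (smallFactor? k r)

ρ : ℕ → ℕ → ℕ
ρ k r = ⟦ rough? k r ⟧

rough-1 : ∀ k → Rough k 1
rough-1 k (p , _ , 2≤p , p∣1) = <⇒≢ 2≤p (sym (∣1⇒≡1 p∣1))

rough-coprime : ∀ {k r j} → Rough k r → 0 < j → j < k → Coprime r j
rough-coprime rough 0<j j<k {zero} (_ , 0∣j) = contradiction (0∣⇒≡0 0∣j) (n>0⇒n≢0 0<j)
rough-coprime rough 0<j j<k {suc zero} _ = refl
rough-coprime rough 0<j j<k {suc (suc d)} (d∣r , d∣j) =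
  contradiction (suc (suc d) , ≤-<-trans (∣⇒≤ {{>-nonZero 0<j}} d∣j) j<k , s≤s (s≤s z≤n) , d∣r) rough

rough-∣ : ∀ {k r r′ j j′} → Rough k r → 0 < j′ → j′ < k → j * r ≡ j′ * r′ → r ∣ r′
rough-∣ {r = r} {j = j} rough 0<j′ j′<k eq =
  coprime-divisor (rough-coprime rough 0<j′ j′<k) (subst (r ∣_) eq (n∣m*n j))

-- Each of `r`, `r′` is coprime to the multiplier on the other side and so divides the other. This
-- is what lets an edge length and `q` determine the rough factor.
rough-unique : ∀ {k r r′ j j′} → Rough k r → Rough k r′ → 0 < j → j < k → 0 < j′ → j′ < k →
               j * r ≡ j′ * r′ → r ≡ r′
rough-unique {j = j} {j′} rough rough′ 0<j j<k 0<j′ j′<k eq = ∣-antisym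
  (rough-∣ {j = j} rough 0<j′ j′<k eq) (rough-∣ {j = j′} rough′ 0<j j<k (sym eq))

-- A power `b ≥ 8` makes the divisor `b * b` rare, as the sum of `1 / b²` over `b ≥ 8` is at most
-- `1 / 7`. The bound `b ≤ 8 * p` keeps `b * b` below `64 * (k * k)` when `p < k`, whence the
-- requirement on `K`.
power-near-8 : ∀ p → 2 ≤ p → ∃[ e ] 8 ≤ p ^ e × p ^ e ≤ 8 * p
power-near-8 1 (s≤s ())
power-near-8 2 _ = 3 , ≤ᵇ⇒≤ _ _ _ , ≤ᵇ⇒≤ _ _ _
power-near-8 3 _ = 2 , ≤ᵇ⇒≤ _ _ _ , ≤ᵇ⇒≤ _ _ _
power-near-8 4 _ = 2 , ≤ᵇ⇒≤ _ _ _ , ≤ᵇ⇒≤ _ _ _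
power-near-8 5 _ = 2 , ≤ᵇ⇒≤ _ _ _ , ≤ᵇ⇒≤ _ _ _
power-near-8 6 _ = 2 , ≤ᵇ⇒≤ _ _ _ , ≤ᵇ⇒≤ _ _ _
power-near-8 7 _ = 2 , ≤ᵇ⇒≤ _ _ _ , ≤ᵇ⇒≤ _ _ _
power-near-8 p@(suc (suc (suc (suc (suc (suc (suc (suc m)))))))) _ =
  1 , subst (8 ≤_) (sym (*-identityʳ p)) (m≤m+n 8 m) , subst (_≤ 8 * p) (sym (*-identityʳ p)) (m≤m+n p _)

-- Every power p^i ≤ K divides gcd c (L K) as long as p still divides the cofactor.
squareDivisor : ∀ {k K c r} → 64 * (k * k) ≤ K → c ≡ r * gcd c (L K) → SmallFactor k r →
                ∃[ b ] 8 ≤ b × b * b ∣ c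
squareDivisor {k} {K} {c} {r} 64k²≤K c-eq (p , p<k , 2≤p , p∣r) with power-near-8 p 2≤p
... | e , 8≤b , b≤8p = p ^ e , 8≤b ,
  subst (_∣ c) (^-distribˡ-+-* p e e) (∣-trans (powers (e + e) b²≤K) (gcd[m,n]∣m c (L K)))
  where
  open ≤-Reasoning
  p>0 : 0 < p
  p>0 = ≤-trans (s≤s z≤n) 2≤p
  instance
    _ = >-nonZero p>0
  b²≤K : p ^ (e + e) ≤ K
  b²≤K = begin
    p ^ (e + e)         ≡⟨ ^-distribˡ-+-* p e e ⟩
    p ^ e * p ^ e       ≤⟨ *-mono-≤ b≤8p b≤8p ⟩
    (8 * p) * (8 * p)   ≡⟨ lemma p ⟩
    64 * (p * p)        ≤⟨ *-monoʳ-≤ 64 (*-mono-≤ (<⇒≤ p<k) (<⇒≤ p<k)) ⟩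
    64 * (k * k)        ≤⟨ 64k²≤K ⟩
    K                   ∎
    where lemma : ∀ p → (8 * p) * (8 * p) ≡ 64 * (p * p)
          lemma = solve-∀
  powers : ∀ i → p ^ i ≤ K → p ^ i ∣ gcd c (L K)
  powers zero    _ = 1∣ _
  powers (suc i) h = gcd-greatest
    (subst (p ^ suc i ∣_) (sym c-eq) (*-pres-∣ p∣r (powers i (≤-trans (m≤n*m (p ^ i) p) h))))
    (≤⇒∣L (m^n>0 p (suc i)) h)

-- Logarithmic averages and the sieve

-- The quotients X / c are X times the weights 1 / c of a logarithmic average over c ≤ X, up to rounding.
μ : ℕ → (ℕ → ℕ) → ℕ
μ X φ = ∑ X (λ i → φ (suc i) * (X / suc i))

-- For 0 < c ≤ X this is φ (c / s) if s ∣ c, and 0 otherwise.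
dilate : ℕ → ℕ → (ℕ → ℕ) → ℕ → ℕ
dilate X s φ c = ∑ X (λ j → ⟦ s * suc j ≟ c ⟧ * φ (suc j))

dilate-point : ∀ X s j φ → j < X → φ (suc j) ≤ dilate X s φ (s * suc j)
dilate-point X s j φ j<X = begin
  φ (suc j)                               ≡⟨ sym (+-identityʳ _) ⟩
  1 * φ (suc j)                           ≡⟨ cong (_* φ (suc j)) (sym (⟦⟧-true (s * suc j ≟ s * suc j) refl)) ⟩
  ⟦ s * suc j ≟ s * suc j ⟧ * φ (suc j)   ≤⟨ term≤∑ (λ j′ → ⟦ s * suc j′ ≟ s * suc j ⟧ * φ (suc j′)) j<X ⟩
  dilate X s φ (s * suc j)                ∎
  where open ≤-Reasoning

dilate-divisor : ∀ X s φ c → 0 < c → c ≤ X → (h : s ∣ c) → φ (quotient h) ≤ dilate X s φ c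
dilate-divisor X s φ c 0<c c≤X (divides zero c≡) = contradiction c≡ (n>0⇒n≢0 0<c)
dilate-divisor X s φ c 0<c c≤X (divides (suc j) c≡) = subst (λ t → φ (suc j) ≤ dilate X s φ t)
  (trans (*-comm s (suc j)) (sym c≡)) (dilate-point X s j φ (≤-trans (∣⇒≤ {{>-nonZero 0<c}} (divides s (trans c≡ (*-comm (suc j) s)))) c≤X))

-- The weight of `s * suc j` is at most `1 / s` of the weight of `suc j`. Rounding does no harm
-- because dividing by `suc j` and then by `s` rounds to the same value as dividing by the product.
point-mass : ∀ X s j → s * ∑ X (λ i → ⟦ s * suc j ≟ suc i ⟧ * (X / suc i)) ≤ X / suc j
point-mass X zero      j = z≤n
point-mass X s@(suc _) j = begin
  s * ∑ X (λ i → ⟦ s * suc j ≟ suc i ⟧ * (X / suc i))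
    ≤⟨ *-monoʳ-≤ s (∑-mono X λ i _ → concentrate i) ⟩
  s * ∑ X (λ i → m * ⟦ s * suc j ≟ suc i ⟧)
    ≡⟨ cong (s *_) (∑-* m X _) ⟩
  s * (m * ∑ X (λ i → ⟦ s * suc j ≟ suc i ⟧))
    ≤⟨ *-monoʳ-≤ s (*-monoʳ-≤ m (∑-unique X (λ i → s * suc j ≟ suc i) λ p q → suc-injective (trans (sym p) q))) ⟩
  s * (m * 1)           ≡⟨ cong (s *_) (trans (*-identityʳ m) (/-congʳ {m = X} (*-comm s (suc j)))) ⟩
  s * (X / (suc j * s)) ≡⟨ cong (s *_) (sym (m/n/o≡m/[n*o] X (suc j) s)) ⟩
  s * (X / suc j / s)   ≡⟨ *-comm s _ ⟩
  X / suc j / s * s     ≤⟨ m/n*n≤m (X / suc j) s ⟩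
  X / suc j             ∎
  where
  open ≤-Reasoning
  m = X / (s * suc j)
  concentrate : ∀ i → ⟦ s * suc j ≟ suc i ⟧ * (X / suc i) ≤ m * ⟦ s * suc j ≟ suc i ⟧
  concentrate i with s * suc j ≟ suc i
  ... | yes eq = ≤-reflexive (trans (+-identityʳ _) (trans (/-congʳ {m = X} (sym eq)) (sym (*-identityʳ m))))
  ... | no  _  = z≤n

-- Logarithmic weights scale: dilation by `s` divides the mean by at least `s`. Every mean in the
-- sieve is estimated through this inequality.
μ-dilate : ∀ X s φ → s * μ X (dilate X s φ) ≤ μ X φ
μ-dilate X s φ = begin
  s * ∑ X (λ i → ∑ X (λ j → δ i j * φ (suc j)) * (X / suc i))
    ≡⟨ cong (s *_) (∑-cong X λ i → trans (*-comm _ (X / suc i)) (sym (∑-* (X / suc i) X _))) ⟩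
  s * ∑ X (λ i → ∑ X (λ j → (X / suc i) * (δ i j * φ (suc j))))
    ≡⟨ cong (s *_) (∑-swap X X _) ⟩
  s * ∑ X (λ j → ∑ X (λ i → (X / suc i) * (δ i j * φ (suc j))))
    ≡⟨ sym (∑-* s X _) ⟩
  ∑ X (λ j → s * ∑ X (λ i → (X / suc i) * (δ i j * φ (suc j))))
    ≤⟨ ∑-mono X (λ j _ → each j) ⟩
  ∑ X (λ j → φ (suc j) * (X / suc j)) ∎
  where
  open ≤-Reasoning
  δ : ℕ → ℕ → ℕ
  δ i j = ⟦ s * suc j ≟ suc i ⟧
  lemma₁ : ∀ a b c → a * (b * c) ≡ c * (b * a)
  lemma₁ = solve-∀
  lemma₂ : ∀ a b c → a * (b * c) ≡ b * (a * c)
  lemma₂ = solve-∀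
  each : ∀ j → s * ∑ X (λ i → (X / suc i) * (δ i j * φ (suc j))) ≤ φ (suc j) * (X / suc j)
  each j = begin
    s * ∑ X (λ i → (X / suc i) * (δ i j * φ (suc j)))
      ≡⟨ cong (s *_) (trans (∑-cong X λ i → lemma₁ (X / suc i) (δ i j) (φ (suc j))) (∑-* (φ (suc j)) X _)) ⟩
    s * (φ (suc j) * ∑ X (λ i → δ i j * (X / suc i)))
      ≡⟨ lemma₂ s (φ (suc j)) _ ⟩
    φ (suc j) * (s * ∑ X (λ i → δ i j * (X / suc i)))
      ≤⟨ *-monoʳ-≤ (φ (suc j)) (point-mass X s j) ⟩
    φ (suc j) * (X / suc j) ∎

μ-mono : ∀ X {φ ψ} → (∀ c → 0 < c → c ≤ X → φ c ≤ ψ c) → μ X φ ≤ μ X ψ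
μ-mono X h = ∑-mono X λ i i<X → *-monoˡ-≤ (X / suc i) (h (suc i) (s≤s z≤n) i<X)

μ-+ : ∀ X φ ψ → μ X (λ c → φ c + ψ c) ≡ μ X φ + μ X ψ
μ-+ X φ ψ = trans (∑-cong X λ i → *-distribʳ-+ (X / suc i) (φ (suc i)) _) (∑-+ X _ _)

μ-* : ∀ X a φ → μ X (λ c → a * φ c) ≡ a * μ X φ
μ-* X a φ = trans (∑-cong X λ i → *-assoc a (φ (suc i)) _) (∑-* a X _)

μ-∑ : ∀ X n (φ : ℕ → ℕ → ℕ) → μ X (λ c → ∑ n (λ s → φ s c)) ≡ ∑ n (λ s → μ X (φ s))
μ-∑ X zero    φ = ∑-zero X
μ-∑ X (suc n) φ = trans (μ-+ X (λ c → ∑ n (λ s → φ s c)) (φ n)) (cong (_+ μ X (φ n)) (μ-∑ X n φ))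

one : ℕ → ℕ
one _ = 1

∑-2^suc : ∀ m f → ∑ (2 ^ suc m) f ≡ ∑ (2 ^ m) f + ∑ (2 ^ m) (λ i → f (2 ^ m + i))
∑-2^suc m f = trans (cong (λ t → ∑ (2 ^ m + t) f) (+-identityʳ (2 ^ m))) (∑-split (2 ^ m) (2 ^ m) f)

-- Each dyadic block contributes at most `T`. The value `f 0` stands apart since the hypothesis says
-- nothing about it.
harmonic-≤ : ∀ m f T → (∀ i → i * f i ≤ T) → ∑ (2 ^ m) f ≤ f 0 + m * T
harmonic-≤ zero    f T h = m≤m+n (f 0) 0
harmonic-≤ (suc m) f T h = begin
  ∑ (2 ^ suc m) f                                    ≡⟨ ∑-2^suc m f ⟩
  ∑ (2 ^ m) f + ∑ (2 ^ m) (λ i → f (2 ^ m + i))      ≤⟨ +-mono-≤ (harmonic-≤ m f T h) block ⟩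
  f 0 + m * T + T                                    ≡⟨ lemma (f 0) m T ⟩
  f 0 + suc m * T                                    ∎
  where
  open ≤-Reasoning
  lemma : ∀ a m T → a + m * T + T ≡ a + suc m * T
  lemma = solve-∀
  block : ∑ (2 ^ m) (λ i → f (2 ^ m + i)) ≤ T
  block = *-cancelˡ-≤ (2 ^ m) {{>-nonZero (2^-pos m)}} (begin
    2 ^ m * ∑ (2 ^ m) (λ i → f (2 ^ m + i))    ≡⟨ sym (∑-* (2 ^ m) (2 ^ m) _) ⟩
    ∑ (2 ^ m) (λ i → 2 ^ m * f (2 ^ m + i))
      ≤⟨ ∑-mono (2 ^ m) (λ i _ → ≤-trans (*-monoˡ-≤ (f (2 ^ m + i)) (m≤m+n (2 ^ m) i)) (h (2 ^ m + i))) ⟩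
    ∑ (2 ^ m) (λ _ → T)                        ≡⟨ ∑-const (2 ^ m) T ⟩
    2 ^ m * T                                  ∎)

≤2*/ : ∀ n q .{{_ : NonZero q}} → q ≤ n → n ≤ 2 * (q * (n / q))
≤2*/ n q q≤n = begin
  n                            ≡⟨ m≡m%n+[m/n]*n n q ⟩
  n % q + n / q * q            ≤⟨ +-monoˡ-≤ _ (≤-trans (<⇒≤ (m%n<n n q)) (≤-trans (≤-reflexive (sym (*-identityʳ q))) (*-monoʳ-≤ q (m≥n⇒m/n>0 q≤n)))) ⟩
  q * (n / q) + n / q * q      ≡⟨ lemma q (n / q) ⟩
  2 * (q * (n / q))            ∎
  where
  open ≤-Reasoning
  lemma : ∀ a b → a * b + b * a ≡ 2 * (a * b)
  lemma = solve-∀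

-- Each dyadic block contributes at least `X / 4`: one factor 2 is lost to the width of the block,
-- another to rounding the quotient down.
μ-one-≥ : ∀ X m → 2 ^ m ≤ X → X * m ≤ 4 * μ X one
μ-one-≥ X m 2^m≤X = ≤-trans (dyadic m 2^m≤X) (*-monoʳ-≤ 4
    (≤-trans (∑-monoˡ _ 2^m≤X) (≤-reflexive (∑-cong X λ i → sym (+-identityʳ _)))))
  where
  open ≤-Reasoning
  dyadic : ∀ m → 2 ^ m ≤ X → X * m ≤ 4 * ∑ (2 ^ m) (λ i → X / suc i)
  dyadic zero    _ = ≤-trans (≤-reflexive (*-zeroʳ X)) z≤n
  dyadic (suc m) h = begin
    X * suc m         ≡⟨ trans (*-suc X m) (+-comm X (X * m)) ⟩
    X * m + X         ≤⟨ +-mono-≤ (dyadic m (≤-trans (m≤m+n (2 ^ m) _) h)) block ⟩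
    4 * ∑ (2 ^ m) (λ i → X / suc i) + 4 * ∑ (2 ^ m) (λ i → X / suc (2 ^ m + i))
      ≡⟨ sym (*-distribˡ-+ 4 (∑ (2 ^ m) _) _) ⟩
    4 * (∑ (2 ^ m) (λ i → X / suc i) + ∑ (2 ^ m) (λ i → X / suc (2 ^ m + i)))
      ≡⟨ cong (4 *_) (sym (∑-2^suc m (λ i → X / suc i))) ⟩
    4 * ∑ (2 ^ suc m) (λ i → X / suc i) ∎
    where
    instance
      _ = >-nonZero (2^-pos (suc m))
    v = X / (2 ^ suc m)
    lemma : ∀ a v → 2 * (2 * a * v) ≡ 4 * (a * v)
    lemma = solve-∀
    block : X ≤ 4 * ∑ (2 ^ m) (λ i → X / suc (2 ^ m + i))
    block = begin
      X                         ≤⟨ ≤2*/ X (2 ^ suc m) h ⟩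
      2 * (2 ^ suc m * v)       ≡⟨ lemma (2 ^ m) v ⟩
      4 * (2 ^ m * v)           ≡⟨ cong (4 *_) (sym (∑-const (2 ^ m) v)) ⟩
      4 * ∑ (2 ^ m) (λ _ → v)   ≤⟨ *-monoʳ-≤ 4 (∑-mono (2 ^ m) λ i i<2^m → /-monoʳ-≤ X
            (≤-trans (≤-reflexive (sym (+-suc (2 ^ m) i))) (+-monoʳ-≤ (2 ^ m) (≤-trans i<2^m (≤-reflexive (sym (+-identityʳ _))))))) ⟩
      4 * ∑ (2 ^ m) (λ i → X / suc (2 ^ m + i)) ∎

-- Telescoping: 1 / b² ≤ 1 / (b - 1) - 1 / b, which survives rounding down.
∑-squares : ∀ n (f : ℕ → ℕ) U → (∀ i → (8 + i) * (8 + i) * f i ≤ U) → 7 * ∑ n f ≤ U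
∑-squares n f U h = begin
  7 * ∑ n f                   ≤⟨ *-monoʳ-≤ 7 (≤-trans (m≤m+n (∑ n f) (U / (7 + n))) (telescope n)) ⟩
  7 * (U / 7)                 ≡⟨ *-comm 7 (U / 7) ⟩
  U / 7 * 7                   ≤⟨ m/n*n≤m U 7 ⟩
  U                           ∎
  where
  open ≤-Reasoning
  step : ∀ i → f i + U / (8 + i) ≤ U / (7 + i)
  step i = begin
    f i + a             ≡⟨ sym (m*n/n≡m (f i + a) (7 + i)) ⟩
    (f i + a) * (7 + i) / (7 + i)
      ≤⟨ /-monoˡ-≤ {(f i + a) * (7 + i)} {U} (7 + i) (*-cancelˡ-≤ (b * b) (begin
           b * b * ((f i + a) * (7 + i))                 ≡⟨ lemma₁ (7 + i) (f i) a ⟩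
           (7 + i) * (b * b * f i) + (7 + i) * b * (a * b)
             ≤⟨ +-mono-≤ (*-monoʳ-≤ (7 + i) (h i)) (*-monoʳ-≤ ((7 + i) * b) (m/n*n≤m U b)) ⟩
           (7 + i) * U + (7 + i) * b * U                 ≤⟨ m≤n+m _ U ⟩
           U + ((7 + i) * U + (7 + i) * b * U)           ≡⟨ lemma₂ (7 + i) U ⟩
           b * b * U                                     ∎)) ⟩
    U / (7 + i)         ∎
    where
    a = U / (8 + i)
    b = 8 + i
    lemma₁ : ∀ c f a → suc c * suc c * ((f + a) * c) ≡ c * (suc c * suc c * f) + c * suc c * (a * suc c)
    lemma₁ = solve-∀
    lemma₂ : ∀ c U → U + (c * U + c * suc c * U) ≡ suc c * suc c * U
    lemma₂ = solve-∀
  telescope : ∀ n → ∑ n f + U / (7 + n) ≤ U / 7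
  telescope zero    = ≤-refl
  telescope (suc n) = begin
    ∑ n f + f n + U / (8 + n)     ≡⟨ +-assoc (∑ n f) (f n) _ ⟩
    ∑ n f + (f n + U / (8 + n))   ≤⟨ +-monoʳ-≤ (∑ n f) (step n) ⟩
    ∑ n f + U / (7 + n)           ≤⟨ telescope n ⟩
    U / 7                         ∎

multiples : ∀ N q → N / suc q ≤ ∑ N (λ i → ⟦ suc q ∣? suc i ⟧)
multiples N q = ≤-trans (blocks (N / suc q)) (∑-monoˡ _ (m/n*n≤m N (suc q)))
  where
  open ≤-Reasoning
  hit : ∀ M → suc q ∣ suc (M * suc q + q)
  hit M = divides (suc M) (lemma M q)
    where lemma : ∀ M q → suc (M * suc q + q) ≡ suc M * suc q
          lemma = solve-∀
  blocks : ∀ M → M ≤ ∑ (M * suc q) (λ i → ⟦ suc q ∣? suc i ⟧)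
  blocks zero    = z≤n
  blocks (suc M) = begin
    suc M                               ≡⟨ +-comm 1 M ⟩
    M + 1                               ≤⟨ +-mono-≤ (blocks M) (≤-reflexive (sym (⟦⟧-true (suc q ∣? suc (M * suc q + q)) (hit M)))) ⟩
    ∑ (M * suc q) g + g (M * suc q + q) ≤⟨ +-monoʳ-≤ _ (term≤∑ (λ i → g (M * suc q + i)) (n<1+n q)) ⟩
    ∑ (M * suc q) g + ∑ (suc q) (λ i → g (M * suc q + i)) ≡⟨ sym (∑-split (M * suc q) (suc q) g) ⟩
    ∑ (M * suc q + suc q) g             ≡⟨ cong (λ t → ∑ t g) (+-comm (M * suc q) (suc q)) ⟩
    ∑ (suc M * suc q) g                 ∎
    where g : ℕ → ℕ
          g i = ⟦ suc q ∣? suc i ⟧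

-- With `f q` about `U / q`, this is the upper bound `log K` for the sum of `Λ(q) / q`. The quotient
-- `K / suc q` is at most the number of multiples of `suc q` up to `K`; exchanging the sums leaves
-- the divisor sums of the numbers up to `K`, each at most `κ`. The factor 2 pays for rounding
-- `K / suc q`.
mertens : ∀ κ (f : ℕ → ℕ) U → (∀ q → suc q * f q ≤ U) → ∑ (2 ^ κ) (λ q → Λ q * f q) ≤ 2 * (U * κ)
mertens κ f U h = *-cancelˡ-≤ K {{>-nonZero (2^-pos κ)}} (begin
  K * ∑ K (λ q → Λ q * f q)                    ≡⟨ sym (∑-* K K _) ⟩
  ∑ K (λ q → K * (Λ q * f q))                  ≤⟨ ∑-mono K each ⟩
  ∑ K (λ q → 2 * U * (Λ q * (K / suc q)))      ≡⟨ ∑-* (2 * U) K _ ⟩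
  2 * U * ∑ K (λ q → Λ q * (K / suc q))        ≤⟨ *-monoʳ-≤ (2 * U) total ⟩
  2 * U * (K * κ)                              ≡⟨ lemma K U κ ⟩
  K * (2 * (U * κ))                            ∎)
  where
  open ≤-Reasoning
  K = 2 ^ κ
  lemma : ∀ K U κ → 2 * U * (K * κ) ≡ K * (2 * (U * κ))
  lemma = solve-∀
  each : ∀ q → q < K → K * (Λ q * f q) ≤ 2 * U * (Λ q * (K / suc q))
  each q q<K = begin
    K * (Λ q * f q)                                  ≤⟨ *-monoˡ-≤ (Λ q * f q) (≤2*/ K (suc q) q<K) ⟩
    2 * (suc q * (K / suc q)) * (Λ q * f q)          ≡⟨ lemma₁ (suc q) (K / suc q) (Λ q) (f q) ⟩
    2 * (suc q * f q) * (Λ q * (K / suc q))          ≤⟨ *-monoˡ-≤ _ (*-monoʳ-≤ 2 (h q)) ⟩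
    2 * U * (Λ q * (K / suc q))                      ∎
    where lemma₁ : ∀ a b c d → 2 * (a * b) * (c * d) ≡ 2 * (a * d) * (c * b)
          lemma₁ = solve-∀
  total : ∑ K (λ q → Λ q * (K / suc q)) ≤ K * κ
  total = begin
    ∑ K (λ q → Λ q * (K / suc q))                            ≤⟨ ∑-mono K (λ q _ → *-monoʳ-≤ (Λ q) (multiples K q)) ⟩
    ∑ K (λ q → Λ q * ∑ K (λ i → ⟦ suc q ∣? suc i ⟧))         ≡⟨ ∑-cong K (λ q → sym (∑-* (Λ q) K _)) ⟩
    ∑ K (λ q → ∑ K (λ i → Λ q * ⟦ suc q ∣? suc i ⟧))         ≡⟨ ∑-swap K K _ ⟩
    ∑ K (λ i → ∑ K (λ q → Λ q * ⟦ suc q ∣? suc i ⟧))         ≡⟨ ∑-cong K (λ i → ∑-cong K λ q → *-comm (Λ q) _) ⟩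
    ∑ K (λ i → ΛDivisors (suc i) K)
      ≤⟨ ∑-mono K (λ i i<K → 2^-cancel-≤ (≤-trans (2^ΛDivisors≤ (suc i) K (s≤s z≤n)) i<K)) ⟩
    ∑ K (λ _ → κ)                                            ≡⟨ ∑-const K κ ⟩
    K * κ                                                    ∎

-- 2 ^ y is the threshold for gcd c (L K); y is a variable so that 16 * κ does not unfold.
module Sieve (k κ y X : ℕ) (y≡ : y ≡ 16 * κ) (64k²≤K : 64 * (k * k) ≤ 2 ^ κ) where
  K = 2 ^ κ

  U T : ℕ
  U = μ X one
  T = μ X (ρ k)

  -- Write `c = r * gcd c (L K)`. These detect three cases: `r` has a small factor, which forces a
  -- square divisor; the gcd is at least `2 ^ suc y`; or `c` is a rough number times a small one.
  -- All are combinations of dilates, so `μ-dilate` controls their means.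
  squareful smooth good : ℕ → ℕ
  squareful c = ∑ X (λ β → dilate X ((8 + β) * (8 + β)) one c)
  smooth    c = ∑ K (λ q → Λ q * dilate X (suc q) one c)
  good      c = ∑ (2 ^ suc y) (λ s → dilate X s (ρ k) c)

  open ≤-Reasoning

  module _ (c : ℕ) (0<c : 0 < c) (c≤X : c ≤ X) where
    squareful-case : SmallFactor k (quotient (gcd[m,n]∣m c (L K))) → 1 ≤ squareful c
    squareful-case small = from (squareDivisor {k} {K} {c} 64k²≤K (m∣n⇒n≡quotient*m (gcd[m,n]∣m c (L K))) small)
      where
      from : ∃[ b ] 8 ≤ b × b * b ∣ c → 1 ≤ squareful c
      from (b , 8≤b , b²∣c) = ≤-trans (dilate-divisor X (b * b) one c 0<c c≤X b²∣c)
        (subst (λ t → dilate X (t * t) one c ≤ squareful c) (m+[n∸m]≡n 8≤b)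
          (term≤∑ (λ β → dilate X ((8 + β) * (8 + β)) one c) β<X))
        where
        β<X : b ∸ 8 < X
        β<X = begin-strict
          b ∸ 8     <⟨ ∸-monoʳ-< {b} {8} {0} (s≤s z≤n) 8≤b ⟩
          b         ≤⟨ m≤m*n b b {{>-nonZero (≤-trans (s≤s z≤n) 8≤b)}} ⟩
          b * b     ≤⟨ ∣⇒≤ {{>-nonZero 0<c}} b²∣c ⟩
          c         ≤⟨ c≤X ⟩
          X         ∎

    good-case : Rough k (quotient (gcd[m,n]∣m c (L K))) → gcd c (L K) < 2 ^ suc y → 1 ≤ good c
    good-case rough s<Y = begin
      1                                     ≡⟨ sym (⟦⟧-true (rough? k _) rough) ⟩
      ρ k (quotient (gcd[m,n]∣m c (L K)))     ≤⟨ dilate-divisor X (gcd c (L K)) (ρ k) c 0<c c≤X (gcd[m,n]∣m c (L K)) ⟩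
      dilate X (gcd c (L K)) (ρ k) c            ≤⟨ term≤∑ (λ s → dilate X s (ρ k) c) s<Y ⟩
      good c                                ∎

    smooth-case : 2 ^ suc y ≤ gcd c (L K) → y ≤ 2 * smooth c
    smooth-case Y≤s = begin
      y                    ≤⟨ n≤1+n y ⟩
      suc y                ≤⟨ 2^-cancel-≤ (≤-trans Y≤s (gcd-L≤ c K 0<c)) ⟩
      2 * ΛDivisors c K    ≤⟨ *-monoʳ-≤ 2 (∑-mono K λ q _ → each q) ⟩
      2 * smooth c         ∎
      where
      each : ∀ q → ⟦ suc q ∣? c ⟧ * Λ q ≤ Λ q * dilate X (suc q) one c
      each q = ⟦⟧*-≤ (suc q ∣? c) λ q∣c → ≤-trans (≤-reflexive (sym (*-identityʳ (Λ q))))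
        (*-monoʳ-≤ (Λ q) (dilate-divisor X (suc q) one c 0<c c≤X q∣c))

    times-y : ∀ {n} → 1 ≤ n → y ≤ y * n
    times-y h = ≤-trans (≤-reflexive (sym (*-identityʳ y))) (*-monoʳ-≤ y h)

    -- The first and last cases are scaled by `y` to match the smooth case, where the divisor sum
    -- itself reaches `y / 2`.
    dichotomy : Dec (SmallFactor k (quotient (gcd[m,n]∣m c (L K)))) → Dec (gcd c (L K) < 2 ^ suc y) →
                y ≤ y * squareful c + 2 * smooth c + y * good c
    dichotomy (yes small) _ = ≤-trans (times-y (squareful-case small))
      (≤-trans (m≤m+n (y * squareful c) (2 * smooth c)) (m≤m+n _ (y * good c)))
    dichotomy (no rough) (yes s<Y) = ≤-trans (times-y (good-case rough s<Y))
      (m≤n+m (y * good c) (y * squareful c + 2 * smooth c))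
    dichotomy (no rough) (no s≮Y)  = ≤-trans (smooth-case (≮⇒≥ s≮Y))
      (≤-trans (m≤n+m (2 * smooth c) (y * squareful c)) (m≤m+n _ (y * good c)))

  squareful≤ : 7 * μ X squareful ≤ U
  squareful≤ = subst (λ t → 7 * t ≤ U) (sym (μ-∑ X X λ β → dilate X ((8 + β) * (8 + β)) one))
    (∑-squares X (λ β → μ X (dilate X ((8 + β) * (8 + β)) one)) U λ β → μ-dilate X ((8 + β) * (8 + β)) one)

  smooth≤ : μ X smooth ≤ 2 * (U * κ)
  smooth≤ = subst (_≤ 2 * (U * κ)) (sym (trans (μ-∑ X K λ q c → Λ q * dilate X (suc q) one c) (∑-cong K λ q → μ-* X (Λ q) (dilate X (suc q) one))))
    (mertens κ (λ q → μ X (dilate X (suc q) one)) U λ q → μ-dilate X (suc q) one)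

  -- Each `s` contributes at most `T / s`, and the harmonic sum below `2 ^ suc y` is at most
  -- `suc y`. The dilate by 0 vanishes on positive arguments.
  good≤ : μ X good ≤ suc y * T
  good≤ = begin
    μ X good                                  ≡⟨ μ-∑ X (2 ^ suc y) (λ s → dilate X s (ρ k)) ⟩
    ∑ (2 ^ suc y) (λ s → μ X (dilate X s (ρ k)))  ≤⟨ harmonic-≤ (suc y) (λ s → μ X (dilate X s (ρ k))) T (λ s → μ-dilate X s (ρ k)) ⟩
    μ X (dilate X 0 (ρ k)) + suc y * T            ≡⟨ cong (_+ suc y * T) zero-dilate ⟩
    suc y * T                                 ∎
    where
    zero-dilate : μ X (dilate X 0 (ρ k)) ≡ 0
    zero-dilate = trans (∑-cong X λ i → cong (_* (X / suc i)) (∑-zero X)) (∑-zero X)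

  -- Averaging `dichotomy` and multiplying by 7 gives `7yU ≤ yU + 28κU + 7y(y + 1)T`. With `y = 16κ`
  -- the middle term is at most `2yU`, so `3yU` cancels and `4yU` survives; this fixes the choice of
  -- `y`.
  U≤-pos : 0 < y → U ≤ 2 * (suc y * T)
  U≤-pos 0<y = *-cancelˡ-≤ (4 * y) {{>-nonZero (*-mono-< {0} {4} {0} {y} (s≤s z≤n) 0<y)}}
    (+-cancelˡ-≤ (3 * (y * U)) _ _ (begin
      3 * (y * U) + 4 * y * U           ≡⟨ lemma₁ y U ⟩
      7 * (y * U)                       ≡⟨ cong (7 *_) (sym (μ-* X y one)) ⟩
      7 * μ X (λ c → y * one c)         ≤⟨ *-monoʳ-≤ 7 (μ-mono X λ c 0<c c≤X → ≤-trans (≤-reflexive (*-identityʳ y)) (dichotomy c 0<c c≤X (smallFactor? k _) (_ <? 2 ^ suc y))) ⟩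
      7 * μ X (λ c → y * squareful c + 2 * smooth c + y * good c)
        ≡⟨ cong (7 *_) (trans (μ-+ X (λ c → y * squareful c + 2 * smooth c) (λ c → y * good c))
             (cong₂ _+_ (trans (μ-+ X (λ c → y * squareful c) (λ c → 2 * smooth c)) (cong₂ _+_ (μ-* X y squareful) (μ-* X 2 smooth))) (μ-* X y good))) ⟩
      7 * (y * μ X squareful + 2 * μ X smooth + y * μ X good)
        ≡⟨ lemma₂ y (μ X squareful) (μ X smooth) (μ X good) ⟩
      y * (7 * μ X squareful) + 14 * μ X smooth + 7 * (y * μ X good)
        ≤⟨ +-mono-≤ (+-mono-≤ (*-monoʳ-≤ y squareful≤) (*-monoʳ-≤ 14 smooth≤)) (*-monoʳ-≤ 7 (*-monoʳ-≤ y good≤)) ⟩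
      y * U + 14 * (2 * (U * κ)) + 7 * (y * (suc y * T))
        ≤⟨ +-mono-≤ (+-monoʳ-≤ (y * U) (≤-trans (m≤m+n _ (4 * (U * κ))) (≤-reflexive (trans (lemma₃ U κ) (cong (λ z → 2 * (z * U)) (sym y≡)))))) (≤-trans (m≤m+n _ (y * (suc y * T))) (≤-reflexive (lemma₄ y (suc y * T)))) ⟩
      y * U + 2 * (y * U) + 4 * y * (2 * (suc y * T))
        ≡⟨ lemma₅ (y * U) (4 * y * (2 * (suc y * T))) ⟩
      3 * (y * U) + 4 * y * (2 * (suc y * T))    ∎))
    where
    lemma₁ : ∀ y U → 3 * (y * U) + 4 * y * U ≡ 7 * (y * U)
    lemma₁ = solve-∀
    lemma₂ : ∀ y a b c → 7 * (y * a + 2 * b + y * c) ≡ y * (7 * a) + 14 * b + 7 * (y * c)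
    lemma₂ = solve-∀
    lemma₃ : ∀ U κ → 14 * (2 * (U * κ)) + 4 * (U * κ) ≡ 2 * (16 * κ * U)
    lemma₃ = solve-∀
    lemma₄ : ∀ y t → 7 * (y * t) + y * t ≡ 4 * y * (2 * t)
    lemma₄ = solve-∀
    lemma₅ : ∀ a b → a + 2 * a + b ≡ 3 * a + b
    lemma₅ = solve-∀

  U≤ : 0 < κ → U ≤ 2 * (suc y * T)
  U≤ 0<κ = U≤-pos (subst (0 <_) (sym y≡) (*-mono-< {0} {16} {0} {κ} (s≤s z≤n) 0<κ))


  X≤T : X ≤ T
  X≤T = aux X ≤-refl
    where
    aux : ∀ n → n ≤ X → n ≤ T
    aux zero _ = z≤n
    aux (suc n) h = begin
      suc n            ≤⟨ h ⟩
      X                ≡⟨ sym (trans (cong (_* (X / 1)) (⟦⟧-true (rough? k 1) (rough-1 k))) (trans (+-identityʳ _) (n/1≡n X))) ⟩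
      ρ k 1 * (X / 1)    ≤⟨ term≤∑ (λ i → ρ k (suc i) * (X / suc i)) (≤-trans (s≤s z≤n) h) ⟩
      T                ∎

  -- The part `X * κ` comes from the rough number 1 alone, the part `X * δ` from the full
  -- logarithmic mean `U`. The constant is `1 + 4 * 2 * 17`, since `suc y ≤ 17 * κ`.
  T-lower : ∀ δ → 0 < κ → 2 ^ δ ≤ X → X * (κ + δ) ≤ 137 * (κ * T)
  T-lower δ 0<κ 2^δ≤X = begin
    X * (κ + δ)                 ≡⟨ *-distribˡ-+ X κ δ ⟩
    X * κ + X * δ               ≤⟨ +-mono-≤ (*-monoˡ-≤ κ X≤T) (≤-trans (μ-one-≥ X δ 2^δ≤X) (*-monoʳ-≤ 4 (U≤ 0<κ))) ⟩
    T * κ + 4 * (2 * (suc y * T)) ≤⟨ +-monoʳ-≤ (T * κ) (*-monoʳ-≤ 4 (*-monoʳ-≤ 2 (*-monoˡ-≤ T (+-monoˡ-≤ y 0<κ)))) ⟩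
    T * κ + 4 * (2 * ((κ + y) * T)) ≡⟨ trans (cong (λ z → T * κ + 4 * (2 * ((κ + z) * T))) y≡) (lemma κ T) ⟩
    137 * (κ * T)               ∎
    where
    lemma : ∀ κ T → T * κ + 4 * (2 * ((κ + 16 * κ) * T)) ≡ 137 * (κ * T)
    lemma = solve-∀

-- The constant is a parameter so that later arithmetic is carried out with a variable instead of
-- the numeral.
SieveBound : ℕ → Set
SieveBound c = ∀ k κ X δ → 64 * (k * k) ≤ 2 ^ κ → 0 < κ → 2 ^ δ ≤ X → X * (κ + δ) ≤ c * (κ * μ X (ρ k))

sieveBound : SieveBound 137
sieveBound k κ X δ 64k²≤K = Sieve.T-lower k κ (16 * κ) X refl 64k²≤K δ

-- Double counting

OnAP : ℕ → ℕ → ℕ → ℕ → Set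
OnAP k a d x = ∃[ i ] i < k × a + i * d ≡ x

onAP? : ∀ k a d x → Dec (OnAP k a d x)
onAP? k a d x = anyUpTo? (λ i → a + i * d ≟ x) k

Spans : ℕ → ℕ → ℕ → ℕ × ℕ → Set
Spans k a d (u , v) = OnAP k a d u × OnAP k a d v

spans? : ∀ k a d e → Dec (Spans k a d e)
spans? k a d (u , v) = onAP? k a d u ×-dec onAP? k a d v

∑ᴸ : ∀ {A : Set} → List A → (A → ℕ) → ℕ
∑ᴸ []       f = 0
∑ᴸ (x ∷ xs) f = f x + ∑ᴸ xs f

∑ᴸ-≤ : ∀ {A : Set} (xs : List A) {f B} → (∀ x → x List.∈ xs → f x ≤ B) → ∑ᴸ xs f ≤ length xs * B
∑ᴸ-≤ []       h = z≤n
∑ᴸ-≤ (x ∷ xs) h = +-mono-≤ (h x (here refl)) (∑ᴸ-≤ xs λ y y∈ → h y (there y∈))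

term≤∑ᴸ : ∀ {A : Set} {xs : List A} (f : A → ℕ) {x} → x List.∈ xs → f x ≤ ∑ᴸ xs f
term≤∑ᴸ {xs = x ∷ xs} f (here refl) = m≤m+n _ _
term≤∑ᴸ {xs = y ∷ xs} f (there x∈)  = ≤-trans (term≤∑ᴸ f x∈) (m≤n+m _ (f y))

-- Common differences are products q r with r k-rough, weighted by Λ⁺ at q.
module DoubleCount (k A D : ℕ) where
  total : (ℕ → ℕ → ℕ) → ℕ
  total F = ∑ D (λ i → ρ k (suc i) * ∑ (D / suc i) (λ q → Λ⁺ q * ∑ A (λ a → F a (suc q * suc i))))

  weight : ℕ
  weight = ∑ D (λ i → ρ k (suc i) * ∑ (D / suc i) Λ⁺)

  total-mono : ∀ {F G} → (∀ a d → a < A → 0 < d → d ≤ D → F a d ≤ G a d) → total F ≤ total G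
  total-mono h = ∑-mono D λ i _ → *-monoʳ-≤ (ρ k (suc i)) (∑-mono (D / suc i) λ q q< →
    *-monoʳ-≤ (Λ⁺ q) (∑-mono A λ a a<A → h a (suc q * suc i) a<A (s≤s z≤n)
      (≤-trans (*-monoˡ-≤ (suc i) q<) (m/n*n≤m D (suc i)))))

  total-+ : ∀ F G → total (λ a d → F a d + G a d) ≡ total F + total G
  total-+ F G = trans (∑-cong D λ i → trans (cong (ρ k (suc i) *_)
    (trans (∑-cong (D / suc i) λ q → trans (cong (Λ⁺ q *_) (∑-+ A _ _)) (*-distribˡ-+ (Λ⁺ q) _ _)) (∑-+ (D / suc i) _ _)))
    (*-distribˡ-+ (ρ k (suc i)) _ _)) (∑-+ D _ _)

  total-const : ∀ x → total (λ _ _ → x) ≡ A * x * weight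
  total-const x = trans (∑-cong D λ i → trans (cong (ρ k (suc i) *_)
      (trans (∑-cong (D / suc i) λ q → trans (cong (Λ⁺ q *_) (∑-const A x)) (*-comm (Λ⁺ q) _)) (∑-* (A * x) (D / suc i) Λ⁺)))
      (lemma (ρ k (suc i)) (A * x) _)) (∑-* (A * x) D _)
    where lemma : ∀ a b c → a * (b * c) ≡ b * (a * c)
          lemma = solve-∀

  total-∑ᴸ : ∀ {E : Set} (es : List E) (F : E → ℕ → ℕ → ℕ) →
             total (λ a d → ∑ᴸ es (λ e → F e a d)) ≡ ∑ᴸ es (λ e → total (F e))
  total-∑ᴸ []       F = trans (total-const 0) (cong (_* weight) (*-zeroʳ A))
  total-∑ᴸ (e ∷ es) F = trans (total-+ (F e) (λ a d → ∑ᴸ es (λ e → F e a d))) (cong (total (F e) +_) (total-∑ᴸ es F))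

  T≤4weight : μ D (ρ k) ≤ 4 * weight
  T≤4weight = begin
    ∑ D (λ i → ρ k (suc i) * (D / suc i))                     ≤⟨ ∑-mono D (λ i _ → *-monoʳ-≤ (ρ k (suc i)) (chebyshev (D / suc i))) ⟩
    ∑ D (λ i → ρ k (suc i) * (4 * ∑ (D / suc i) Λ⁺))          ≡⟨ ∑-cong D (λ i → lemma (ρ k (suc i)) _) ⟩
    ∑ D (λ i → 4 * (ρ k (suc i) * ∑ (D / suc i) Λ⁺))          ≡⟨ ∑-* 4 D _ ⟩
    4 * weight                                              ∎
    where
    open ≤-Reasoning
    lemma : ∀ a b → a * (4 * b) ≡ 4 * (a * b)
    lemma = solve-∀

  module _ (u m : ℕ) (0<m : 0 < m) where
    -- What a progression through `u` and `u + m` demands of its difference: `m` is a multiple of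
    -- `d` by a factor below `k`.
    Compatible : ℕ → Set
    Compatible d = d ∣ m × m < k * d

    compatible? : ∀ d → Dec (Compatible d)
    compatible? d = d ∣? m ×-dec m <? k * d

    spans⇒compatible : ∀ {a d} → 0 < d → Spans k a d (u , u + m) → Compatible d
    spans⇒compatible {a} {d} 0<d ((i , i<k , eqᵤ) , (j , j<k , eqᵥ)) =
      ∣m+n∣m⇒∣n (subst (d ∣_) jd≡ (n∣m*n j)) (n∣m*n i) ,
      ≤-<-trans (≤-trans (m≤n+m m (i * d)) (≤-reflexive (sym jd≡))) (*-monoˡ-< d {{>-nonZero 0<d}} j<k)
      where
      jd≡ : j * d ≡ i * d + m
      jd≡ = +-cancelˡ-≡ a _ _ (trans eqᵥ (trans (cong (_+ m) (sym eqᵤ)) (+-assoc a (i * d) m)))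

    -- For fixed `d`, the position `i < k` of the endpoint `u` determines the start `a`.
    starts≤ : ∀ d → 0 < d → ∑ A (λ a → ⟦ spans? k a d (u , u + m) ⟧) ≤ k * ⟦ compatible? d ⟧
    starts≤ d 0<d with compatible? d
    ... | no ¬c = ≤-trans (∑-mono A none) (≤-trans (≤-reflexive (∑-zero A)) z≤n)
      where
      none : ∀ a → a < A → ⟦ spans? k a d (u , u + m) ⟧ ≤ 0
      none a _ = ≤-trans (≤-reflexive (sym (*-identityʳ _)))
        (⟦⟧*-≤ (spans? k a d (u , u + m)) λ sp → contradiction (spans⇒compatible 0<d sp) ¬c)
    ... | yes _ = begin
      ∑ A (λ a → ⟦ spans? k a d (u , u + m) ⟧)        ≤⟨ ∑-mono A (λ a _ → each a) ⟩
      ∑ A (λ a → ∑ k (λ i → ⟦ a + i * d ≟ u ⟧))       ≡⟨ ∑-swap A k _ ⟩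
      ∑ k (λ i → ∑ A (λ a → ⟦ a + i * d ≟ u ⟧))
        ≤⟨ ∑-mono k (λ i _ → ∑-unique A (λ a → a + i * d ≟ u) λ p q → +-cancelʳ-≡ (i * d) _ _ (trans p (sym q))) ⟩
      ∑ k (λ _ → 1)                                   ≡⟨ ∑-const k 1 ⟩
      k * 1                                           ∎
      where
      open ≤-Reasoning
      each : ∀ a → ⟦ spans? k a d (u , u + m) ⟧ ≤ ∑ k (λ i → ⟦ a + i * d ≟ u ⟧)
      each a = ≤-trans (≤-reflexive (sym (*-identityʳ _)))
        (⟦⟧*-≤ (spans? k a d (u , u + m)) λ ((i , i<k , eq) , _) →
          ≤-trans (≤-reflexive (sym (⟦⟧-true (a + i * d ≟ u) eq))) (term≤∑ (λ i → ⟦ a + i * d ≟ u ⟧) i<k))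

    Cofactor : ℕ → ℕ → Set
    Cofactor q i = Rough k (suc i) × Compatible (suc q * suc i)

    cofactor? : ∀ q i → Dec (Cofactor q i)
    cofactor? q i = rough? k (suc i) ×-dec compatible? (suc q * suc i)

    -- Cancelling `suc q` from the two factorisations of `m` leaves products of a rough number with
    -- a multiplier below `k`, where `rough-unique` applies.
    cofactor-unique : ∀ q {i j} → Cofactor q i → Cofactor q j → i ≡ j
    cofactor-unique q {i} {j} (ri , divides x m≡ , m<) (rj , divides x′ m≡′ , m<′) = suc-injective
      (rough-unique {j = x} {x′} ri rj (pos x m≡) (small x i m≡ m<) (pos x′ m≡′) (small x′ j m≡′ m<′)
        (*-cancelˡ-≡ _ _ (suc q) (trans (lemma (suc q) x (suc i)) (trans (trans (sym m≡) m≡′) (sym (lemma (suc q) x′ (suc j)))))))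
      where
      lemma : ∀ q x r → q * (x * r) ≡ x * (q * r)
      lemma = solve-∀
      pos : ∀ x {d} → m ≡ x * d → 0 < x
      pos zero    eq = contradiction eq (n>0⇒n≢0 0<m)
      pos (suc x) _  = s≤s z≤n
      small : ∀ x i → m ≡ x * (suc q * suc i) → m < k * (suc q * suc i) → x < k
      small x i eq lt = *-cancelʳ-< (suc q * suc i) x k (subst (_< k * (suc q * suc i)) eq lt)

    cofactors≤ : ∀ q → ∑ D (λ i → ⟦ cofactor? q i ⟧) ≤ ⟦ suc q ∣? m ⟧
    cofactors≤ q with suc q ∣? m
    ... | yes _ = ∑-unique D (cofactor? q) (cofactor-unique q)
    ... | no q∤m = ≤-trans (∑-mono D none) (≤-reflexive (∑-zero D))
      where
      none : ∀ i → i < D → ⟦ cofactor? q i ⟧ ≤ 0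
      none i _ = ≤-trans (≤-reflexive (sym (*-identityʳ _)))
        (⟦⟧*-≤ (cofactor? q i) λ (_ , d∣m , _) → contradiction (∣-trans (m∣m*n (suc i)) d∣m) q∤m)

    -- For each `q` at most one rough factor survives, and only if `suc q` divides `m`; the total
    -- weight is then `k` times a divisor sum. The successor is the extra unit of `Λ⁺`.
    edge≤ : total (λ a d → ⟦ spans? k a d (u , u + m) ⟧) ≤ k * suc (ΛDivisors m D)
    edge≤ = begin
      total (λ a d → ⟦ spans? k a d (u , u + m) ⟧)
        ≤⟨ ∑-mono D (λ i _ → *-monoʳ-≤ (ρ k (suc i)) (∑-mono (D / suc i) λ q _ → *-monoʳ-≤ (Λ⁺ q) (starts≤ (suc q * suc i) (s≤s z≤n)))) ⟩
      ∑ D (λ i → ρ k (suc i) * ∑ (D / suc i) (λ q → Λ⁺ q * (k * ⟦ compatible? (suc q * suc i) ⟧)))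
        -- Enlarging the range of `q` to `D` makes it independent of `i`, so the sums can be
        -- exchanged.
        ≤⟨ ∑-mono D (λ i _ → *-monoʳ-≤ (ρ k (suc i)) (∑-monoˡ _ (m/n≤m D (suc i)))) ⟩
      ∑ D (λ i → ρ k (suc i) * ∑ D (λ q → Λ⁺ q * (k * ⟦ compatible? (suc q * suc i) ⟧)))
        ≡⟨ ∑-cong D (λ i → sym (∑-* (ρ k (suc i)) D _)) ⟩
      ∑ D (λ i → ∑ D (λ q → ρ k (suc i) * (Λ⁺ q * (k * ⟦ compatible? (suc q * suc i) ⟧))))
        ≤⟨ ∑-mono D (λ i _ → ∑-mono D λ q _ → merge q i) ⟩
      ∑ D (λ i → ∑ D (λ q → k * (Λ⁺ q * ⟦ cofactor? q i ⟧)))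
        ≡⟨ ∑-swap D D _ ⟩
      ∑ D (λ q → ∑ D (λ i → k * (Λ⁺ q * ⟦ cofactor? q i ⟧)))
        ≡⟨ ∑-cong D (λ q → trans (∑-* k D _) (cong (k *_) (∑-* (Λ⁺ q) D _))) ⟩
      ∑ D (λ q → k * (Λ⁺ q * ∑ D (λ i → ⟦ cofactor? q i ⟧)))
        ≡⟨ ∑-* k D _ ⟩
      k * ∑ D (λ q → Λ⁺ q * ∑ D (λ i → ⟦ cofactor? q i ⟧))
        ≤⟨ *-monoʳ-≤ k (∑-mono D (λ q _ → ≤-trans (*-monoʳ-≤ (Λ⁺ q) (cofactors≤ q)) (≤-reflexive (*-comm (Λ⁺ q) _)))) ⟩
      k * ∑ D (λ q → ⟦ suc q ∣? m ⟧ * Λ⁺ q)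
        ≤⟨ *-monoʳ-≤ k (∑Λ⁺ D (λ q → ⟦ suc q ∣? m ⟧) (⟦⟧≤1 (1 ∣? m))) ⟩
      k * suc (ΛDivisors m D) ∎
      where
      open ≤-Reasoning
      merge : ∀ q i → ρ k (suc i) * (Λ⁺ q * (k * ⟦ compatible? (suc q * suc i) ⟧)) ≤ k * (Λ⁺ q * ⟦ cofactor? q i ⟧)
      merge q i with rough? k (suc i) | compatible? (suc q * suc i)
      ... | yes _ | yes _ = ≤-reflexive (lemma (Λ⁺ q) k 1)
        where lemma : ∀ a b c → 1 * (a * (b * c)) ≡ b * (a * c)
              lemma = solve-∀
      ... | yes _ | no _  = ≤-reflexive (lemma (Λ⁺ q) k 0)
        where lemma : ∀ a b c → 1 * (a * (b * c)) ≡ b * (a * c)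
              lemma = solve-∀
      ... | no _  | _     = z≤n

  doubleCount : ∀ {E : Set} (es : List E) (ends : E → ℕ × ℕ) B →
    (∀ e → e List.∈ es → proj₁ (ends e) < proj₂ (ends e)) →
    (∀ e → e List.∈ es → suc (ΛDivisors (proj₂ (ends e) ∸ proj₁ (ends e)) D) ≤ B) →
    (∀ a d → a < A → 0 < d → d ≤ D → 0 < ∑ᴸ es (λ e → ⟦ spans? k a d (ends e) ⟧)) →
    A * weight ≤ length es * (k * B)
  doubleCount es ends B u<v few all = begin
    A * weight                                                     ≡⟨ cong (_* weight) (sym (*-identityʳ A)) ⟩
    A * 1 * weight                                                 ≡⟨ sym (total-const 1) ⟩
    total (λ _ _ → 1)                                              ≤⟨ total-mono all ⟩
    total (λ a d → ∑ᴸ es (λ e → ⟦ spans? k a d (ends e) ⟧))        ≡⟨ total-∑ᴸ es (λ e a d → ⟦ spans? k a d (ends e) ⟧) ⟩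
    ∑ᴸ es (λ e → total (λ a d → ⟦ spans? k a d (ends e) ⟧))        ≤⟨ ∑ᴸ-≤ es each ⟩
    length es * (k * B)                                            ∎
    where
    open ≤-Reasoning
    each : ∀ e → e List.∈ es → total (λ a d → ⟦ spans? k a d (ends e) ⟧) ≤ k * B
    each e e∈ = ≤-trans
      (subst (λ v → total (λ a d → ⟦ spans? k a d (u , v) ⟧) ≤ k * suc (ΛDivisors (v′ ∸ u) D))
        (m+[n∸m]≡n (<⇒≤ (u<v e e∈))) (edge≤ u (v′ ∸ u) (m<n⇒0<n∸m (u<v e e∈))))
      (*-monoʳ-≤ k (few e e∈))
      where
      u = proj₁ (ends e)
      v′ = proj₂ (ends e)

-- Independent progressions in a graph

module _ {n : ℕ} {P : Fin n → Set} (P? : ∀ v → Dec (P v)) where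
  select : Subset n
  select = tabulate (λ v → does (P? v))

  ∈-select⁺ : ∀ {v} → P v → v ∈ select
  ∈-select⁺ {v} pv = lookup⇒[]= v select (trans (lookup∘tabulate _ v) (dec-true (P? v) pv))

  ∈-select⁻ : ∀ {v} → v ∈ select → P v
  ∈-select⁻ {v} v∈ with P? v | trans (sym (lookup∘tabulate (λ v → does (P? v)) v)) ([]=⇒lookup v∈)
  ... | yes pv | _ = pv
  ... | no _   | ()

endpoints : ∀ {n} → Fin n × Fin n → ℕ × ℕ
endpoints (u , v) = toℕ u , toℕ v

spanned : ∀ {n} → Graph n → ℕ → ℕ → ℕ → ℕ
spanned G k a d = ∑ᴸ (edges G) (λ e → ⟦ spans? k a d (endpoints e) ⟧)

module _ {n : ℕ} (G : Graph n) where
  edge? = λ ((u , v) : Fin n × Fin n) → (u Fin.<? v) ×-dec adj? G u v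

  ∈-edges⁺ : ∀ {u v} → toℕ u < toℕ v → Adj G u v → (u , v) List.∈ edges G
  ∈-edges⁺ u<v uv = ∈-filter⁺ edge? (∈-cartesianProduct⁺ (∈-allFin _) (∈-allFin _)) (u<v , uv)

  ∈-edges⁻ : ∀ e → e List.∈ edges G → proj₁ (endpoints e) < proj₂ (endpoints e)
  ∈-edges⁻ e e∈ = proj₁ (proj₂ (∈-filter⁻ edge? {xs = cartesianProduct (allFin n) (allFin n)} e∈))

  independentAP : ∀ k a d → 0 < d → (∀ i → i < k → a + i * d < n) → spanned G k a d ≡ 0 →
                  ∃[ S ] IsAP k {n} S × Independent G S
  -- Indices start at 0 and labels at 1, so the progression of labels starts at `suc a`.
  independentAP k a d 0<d fits none = S , (suc a , d , 0<d , λ x → mk⇔ (to x) (from x)) , indep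
    where
    S = select (λ v → onAP? k a d (toℕ v))
    to : ∀ x → ∃[ v ] v ∈ S × label v ≡ x → ∃[ i ] i < k × x ≡ suc a + i * d
    to x (v , v∈ , refl) with ∈-select⁻ (λ v → onAP? k a d (toℕ v)) v∈
    ... | i , i<k , eq = i , i<k , cong suc (sym eq)
    from : ∀ x → ∃[ i ] i < k × x ≡ suc a + i * d → ∃[ v ] v ∈ S × label v ≡ x
    from x (i , i<k , refl) = fromℕ< (fits i i<k) ,
      ∈-select⁺ (λ v → onAP? k a d (toℕ v)) (i , i<k , sym (toℕ-fromℕ< (fits i i<k))) ,
      cong suc (toℕ-fromℕ< (fits i i<k))
    no-edge : ∀ u v → u ∈ S → v ∈ S → toℕ u < toℕ v → ¬ Adj G u v
    no-edge u v u∈ v∈ u<v uv = contradiction (begin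
      1                                       ≡⟨ sym (⟦⟧-true (spans? k a d (endpoints (u , v)))
                                                   (∈-select⁻ (λ v → onAP? k a d (toℕ v)) u∈ , ∈-select⁻ (λ v → onAP? k a d (toℕ v)) v∈)) ⟩
      ⟦ spans? k a d (endpoints (u , v)) ⟧    ≤⟨ term≤∑ᴸ (λ e → ⟦ spans? k a d (endpoints e) ⟧) (∈-edges⁺ u<v uv) ⟩
      spanned G k a d                         ≡⟨ none ⟩
      0                                       ∎) λ ()
      where open ≤-Reasoning
    indep : Independent G S
    indep u v u∈ v∈ uv with <-cmp (toℕ u) (toℕ v)
    ... | tri< u<v _ _ = no-edge u v u∈ v∈ u<v uv
    ... | tri> _ _ v<u = no-edge v u v∈ u∈ v<u (adj-sym G uv)
    ... | tri≈ _ u≡v _ = no-loop G u (subst (Adj G u) (sym (toℕ-injective u≡v)) uv)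

  -- A bounded search over starts and differences is decidable, which turns the refuted universal
  -- statement into an actual progression.
  findAP : ∀ k A D → (∀ a d i → a < A → d ≤ D → i < k → a + i * d < n) →
           ¬ (∀ a d → a < A → 0 < d → d ≤ D → 0 < spanned G k a d) →
           ∃[ S ] IsAP k {n} S × Independent G S
  findAP k A D fits ¬all with anyUpTo? (λ a → anyUpTo? (λ d → spanned G k a (suc d) ≟ 0) D) A
  ... | yes (a , a<A , d , d<D , none) =
    independentAP k a (suc d) (s≤s z≤n) (λ i i<k → fits a (suc d) i a<A d<D i<k) none
  ... | no ¬ex = contradiction all ¬all
    where
    all : ∀ a d → a < A → 0 < d → d ≤ D → 0 < spanned G k a d
    all a (suc d) a<A _ d<D = n≢0⇒n>0 λ none → ¬ex (a , a<A , d , d<D , none)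

-- The constant 320 c comes from n² ≤ 8 k D A, D A ≤ 4 c κ e k and κ ≤ 10 ℓ.
module Assembly {n : ℕ} (G : Graph n) (k ℓ c : ℕ)
  (0<ℓ : 0 < ℓ) (2^ℓ≤k : 2 ^ ℓ ≤ k) (k<2^1+ℓ : k < 2 ^ suc ℓ) (2k≤n : 2 * k ≤ n)
  (sieve : SieveBound c)
  where
  open ≤-Reasoning
  e = edgeCount G
  -- Chosen so that `64 * (2 ^ suc ℓ)²` equals `2 ^ κ`.
  κ = 8 + 2 * ℓ
  0<k : 0 < k
  0<k = ≤-trans (2^-pos ℓ) 2^ℓ≤k
  instance
    2k≢0 : NonZero (2 * k)
    2k≢0 = >-nonZero (*-mono-< {0} {2} {0} {k} (s≤s z≤n) 0<k)
  -- Progressions with differences up to `D` extend over at most half of the interval, so at least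
  -- `n / 2` starts remain.
  D = n / (2 * k)
  A = n ∸ k * D
  δ = lg D

  2kD≤n : k * D + k * D ≤ n
  2kD≤n = ≤-trans (≤-reflexive (lemma k D)) (m/n*n≤m n (2 * k))
    where lemma : ∀ k D → k * D + k * D ≡ D * (2 * k)
          lemma = solve-∀

  kD≤n : k * D ≤ n
  kD≤n = ≤-trans (m≤m+n _ _) 2kD≤n

  0<D : 0 < D
  0<D = m≥n⇒m/n>0 2k≤n

  n≤2A : n ≤ 2 * A
  n≤2A = begin
    n                            ≡⟨ sym (m+[n∸m]≡n kD≤n) ⟩
    k * D + A                    ≤⟨ +-monoˡ-≤ A (≤-trans (≤-reflexive (sym (m+n∸n≡m (k * D) (k * D)))) (∸-monoˡ-≤ (k * D) 2kD≤n)) ⟩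
    A + A                        ≡⟨ cong (A +_) (sym (+-identityʳ A)) ⟩
    2 * A                        ∎

  n≤4kD : n ≤ 4 * (k * D)
  n≤4kD = ≤-trans (≤2*/ n (2 * k) 2k≤n) (≤-reflexive (lemma k D))
    where lemma : ∀ k D → 2 * (2 * k * D) ≡ 4 * (k * D)
          lemma = solve-∀

  fits : ∀ a d i → a < A → d ≤ D → i < k → a + i * d < n
  fits a d i a<A d≤D i<k = begin-strict
    a + i * d       <⟨ +-mono-<-≤ a<A (*-mono-≤ (<⇒≤ i<k) d≤D) ⟩
    A + k * D       ≡⟨ m∸n+n≡m kD≤n ⟩
    n               ∎

  64k²≤K : 64 * (k * k) ≤ 2 ^ κ
  64k²≤K = begin
    64 * (k * k)                      ≤⟨ *-monoʳ-≤ 64 (*-mono-≤ (<⇒≤ k<2^1+ℓ) (<⇒≤ k<2^1+ℓ)) ⟩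
    64 * (2 ^ suc ℓ * 2 ^ suc ℓ)      ≡⟨ cong (64 *_) (sym (^-distribˡ-+-* 2 (suc ℓ) (suc ℓ))) ⟩
    2 ^ 6 * 2 ^ (suc ℓ + suc ℓ)       ≡⟨ sym (^-distribˡ-+-* 2 6 (suc ℓ + suc ℓ)) ⟩
    2 ^ (6 + (suc ℓ + suc ℓ))         ≡⟨ cong (2 ^_) (lemma ℓ) ⟩
    2 ^ κ                             ∎
    where lemma : ∀ ℓ → 6 + (suc ℓ + suc ℓ) ≡ 8 + 2 * ℓ
          lemma = solve-∀

  -- Since `n ≤ 4 * (k * D)`, the logarithm of `m` is at most `ℓ + δ` plus a constant. It is bounded
  -- by `κ + δ` because that factor also occurs in `SieveBound`.
  divisors≤ : ∀ m → 0 < m → m < n → suc (ΛDivisors m D) ≤ κ + δ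
  divisors≤ m 0<m m<n = ≤-trans (2^-cancel-< {ΛDivisors m D} {2 + (suc ℓ + suc δ)} (begin-strict
    2 ^ ΛDivisors m D              ≤⟨ 2^ΛDivisors≤ m D 0<m ⟩
    m                              <⟨ m<n ⟩
    n                              ≤⟨ n≤4kD ⟩
    4 * (k * D)                    ≤⟨ *-monoʳ-≤ 4 (*-mono-≤ (<⇒≤ k<2^1+ℓ) (<⇒≤ (<2^1+lg D))) ⟩
    4 * (2 ^ suc ℓ * 2 ^ suc δ)    ≡⟨ cong (4 *_) (sym (^-distribˡ-+-* 2 (suc ℓ) (suc δ))) ⟩
    2 ^ 2 * 2 ^ (suc ℓ + suc δ)    ≡⟨ sym (^-distribˡ-+-* 2 2 (suc ℓ + suc δ)) ⟩
    2 ^ (2 + (suc ℓ + suc δ))      ∎))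
    (≤-trans (≤-reflexive (lemma₁ ℓ δ)) (≤-trans (m≤m+n (ℓ + δ + 4) (ℓ + 4)) (≤-reflexive (lemma₂ ℓ δ))))
    where
    lemma₁ : ∀ ℓ δ → 2 + (suc ℓ + suc δ) ≡ ℓ + δ + 4
    lemma₁ = solve-∀
    lemma₂ : ∀ ℓ δ → ℓ + δ + 4 + (ℓ + 4) ≡ 8 + 2 * ℓ + δ
    lemma₂ = solve-∀

  open DoubleCount k A D

  T = μ D (ρ k)

  -- The sieve bounds `weight` below and the double count bounds it above; both carry the factor
  -- `κ + δ`, which cancels and with it the dependence on `log n`.
  DA≤ : (∀ a d → a < A → 0 < d → d ≤ D → 0 < spanned G k a d) → D * A ≤ c * (4 * (κ * (e * k)))
  DA≤ all = *-cancelʳ-≤ (D * A) _ (κ + δ) (begin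
    D * A * (κ + δ)             ≡⟨ lemma₁ D A (κ + δ) ⟩
    A * (D * (κ + δ))           ≤⟨ *-monoʳ-≤ A (sieve k κ D δ 64k²≤K (s≤s z≤n) (2^lg≤ D 0<D)) ⟩
    A * (c * (κ * T))           ≤⟨ *-monoʳ-≤ A (*-monoʳ-≤ c (*-monoʳ-≤ κ T≤4weight)) ⟩
    A * (c * (κ * (4 * weight))) ≡⟨ lemma₂ A c κ weight ⟩
    c * (4 * κ) * (A * weight)  ≤⟨ *-monoʳ-≤ (c * (4 * κ)) (doubleCount (edges G) endpoints (κ + δ) (∈-edges⁻ G)
                                     (λ (u , v) uv∈ → divisors≤ (toℕ v ∸ toℕ u) (m<n⇒0<n∸m (∈-edges⁻ G (u , v) uv∈))
                                       (≤-<-trans (m∸n≤m (toℕ v) (toℕ u)) (toℕ<n v))) all) ⟩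
    c * (4 * κ) * (e * (k * (κ + δ))) ≡⟨ lemma₃ c κ e k (κ + δ) ⟩
    c * (4 * (κ * (e * k))) * (κ + δ) ∎)
    where
    lemma₁ : ∀ D A x → D * A * x ≡ A * (D * x)
    lemma₁ = solve-∀
    lemma₂ : ∀ A c κ w → A * (c * (κ * (4 * w))) ≡ c * (4 * κ) * (A * w)
    lemma₂ = solve-∀
    lemma₃ : ∀ c κ e k x → c * (4 * κ) * (e * (k * x)) ≡ c * (4 * (κ * (e * k))) * x
    lemma₃ = solve-∀

  κ≤10ℓ : κ ≤ 10 * ℓ
  κ≤10ℓ = ≤-trans (+-monoˡ-≤ (2 * ℓ) (≤-trans (≤-reflexive (sym (*-identityʳ 8))) (*-monoʳ-≤ 8 0<ℓ))) (≤-reflexive (lemma ℓ))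
    where lemma : ∀ ℓ → 8 * ℓ + 2 * ℓ ≡ 10 * ℓ
          lemma = solve-∀

  n²≤ : (∀ a d → a < A → 0 < d → d ≤ D → 0 < spanned G k a d) → n * n ≤ 320 * c * (e * (k * k * ℓ))
  n²≤ all = begin
    n * n                                      ≤⟨ *-mono-≤ n≤4kD n≤2A ⟩
    4 * (k * D) * (2 * A)                      ≡⟨ lemma₁ k D A ⟩
    8 * (k * (D * A))                          ≤⟨ *-monoʳ-≤ 8 (*-monoʳ-≤ k (DA≤ all)) ⟩
    8 * (k * (c * (4 * (κ * (e * k)))))        ≤⟨ *-monoʳ-≤ 8 (*-monoʳ-≤ k (*-monoʳ-≤ c (*-monoʳ-≤ 4 (*-monoˡ-≤ (e * k) κ≤10ℓ)))) ⟩
    8 * (k * (c * (4 * (10 * ℓ * (e * k)))))   ≡⟨ lemma₂ k c ℓ e ⟩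
    8 * (4 * 10) * c * (e * (k * k * ℓ))       ∎
    where
    lemma₁ : ∀ k D A → 4 * (k * D) * (2 * A) ≡ 8 * (k * (D * A))
    lemma₁ = solve-∀
    lemma₂ : ∀ k c ℓ e → 8 * (k * (c * (4 * (10 * ℓ * (e * k))))) ≡ 8 * (4 * 10) * c * (e * (k * k * ℓ))
    lemma₂ = solve-∀

  assemble : 320 * c * (e * (k * k * ℓ)) < n * n → ∃[ S ] IsAP k {n} S × Independent G S
  assemble lt = findAP G k A D fits λ all → <⇒≱ lt (n²≤ all)

-- Real numbers

harmonic≥0 : ∀ b l → 0ℚ ℚ.≤ harmonic b l
harmonic≥0 b l = ℚ.≤-trans (ℚ.≤-reflexive (sym (frac-zero (b + l))))
  (ℚ.≤-trans (frac-≤ 0 (b + l) l (b + l) z≤n) (harmonic-lower b l (b + l) (n≤1+n _)))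

½≤harmonic : ∀ p → ½ ℚ.≤ harmonic (suc p) (suc p)
½≤harmonic p = ℚ.≤-trans
  (frac-≤ 1 1 (suc p) (p + suc p) (≤-reflexive (lemma p)))
  (harmonic-lower (suc p) (suc p) (p + suc p) ≤-refl)
  where lemma : ∀ p → 1 * suc (p + suc p) ≡ suc p * 2
        lemma = solve-∀

ι : ℕ → ℚ
ι n = ℤ.+ n ℚ./ 1

ι-+ : ∀ m n → ι (m + n) ≡ ι m ℚ.+ ι n
ι-+ zero    n = sym (ℚ.+-identityˡ (ι n))
ι-+ (suc m) n = trans (frac-suc (m + n) 0) (trans (cong (ι 1 ℚ.+_) (ι-+ m n))
  (trans (sym (ℚ.+-assoc (ι 1) (ι m) (ι n))) (cong (ℚ._+ ι n) (sym (frac-suc m 0)))))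

ι-* : ∀ m n → ι (m * n) ≡ ι m ℚ.* ι n
ι-* zero    n = sym (ℚ.*-zeroˡ (ι n))
ι-* (suc m) n = trans (ι-+ n (m * n)) (trans (cong₂ ℚ._+_ (sym (ℚ.*-identityˡ (ι n))) (ι-* m n))
  (trans (sym (ℚ.*-distribʳ-+ (ι n) 1ℚ (ι m))) (cong (ℚ._* ι n) (sym (frac-suc m 0)))))

0≤ι : ∀ n → 0ℚ ℚ.≤ ι n
0≤ι n = frac-≤ 0 0 n 0 z≤n

0<ι : ∀ n → 0ℚ ℚ.< ι (suc n)
0<ι n = ℚ.positive⁻¹ (ι (suc n)) {{ℚ.normalize-pos (suc n) 1}}

ι-cancel-≤ : ∀ {m n} → ι m ℚ.≤ ι n → m ≤ n
ι-cancel-≤ {m} {n} h = ≮⇒≥ λ n<m → ℚ.<-irrefl refl (ℚ.<-≤-trans (subst₂ ℚ._<_ (ℚ.+-identityʳ (ι n))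
    (trans (sym (ι-+ n _)) (cong ι (trans (+-suc n _) (m+[n∸m]≡n n<m))))
    (ℚ.+-monoʳ-< (ι n) (0<ι (m ∸ suc n)))) h)

-- Each doubling of the range contributes at least ½.
harmonic-dyadic : ∀ ℓ N j → 2 ^ ℓ ≤ suc j → ι ℓ ℚ.≤ harmonic (suc N) (j * suc N) ℚ.+ harmonic (suc N) (j * suc N)
harmonic-dyadic zero N j _ = ℚ.≤-trans (ℚ.≤-reflexive (sym (ℚ.+-identityˡ 0ℚ)))
  (ℚ.+-mono-≤ (harmonic≥0 (suc N) (j * suc N)) (harmonic≥0 (suc N) (j * suc N)))
harmonic-dyadic (suc ℓ) N j 2^1+ℓ≤1+j with 2 ^ ℓ in eq
... | zero  = contradiction eq (n>0⇒n≢0 (2^-pos ℓ))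
... | suc h = begin
  ι (suc ℓ)                                ≡⟨ frac-suc ℓ 0 ⟩
  1ℚ ℚ.+ ι ℓ                               ≤⟨ ℚ.+-mono-≤ (ℚ.+-mono-≤ ½≤Y ½≤Y) (harmonic-dyadic ℓ N h (≤-reflexive eq)) ⟩
  (Y ℚ.+ Y) ℚ.+ (Z ℚ.+ Z)                  ≡⟨ rearrange Y Z ⟩
  (Z ℚ.+ Y) ℚ.+ (Z ℚ.+ Y)                  ≤⟨ ℚ.+-mono-≤ pieces pieces ⟩
  harmonic M (j * M) ℚ.+ harmonic M (j * M) ∎
  where
  open ℚ.≤-Reasoning
  M = suc N
  Y = harmonic (suc h * M) (suc h * M)
  Z = harmonic M (h * M)
  ½≤Y : ½ ℚ.≤ Y
  ½≤Y = ½≤harmonic (N + h * M)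
  r = j ∸ (h + suc h)
  rearrange : ∀ y z → (y ℚ.+ y) ℚ.+ (z ℚ.+ z) ≡ (z ℚ.+ y) ℚ.+ (z ℚ.+ y)
  rearrange = solve 2 (λ y z → (y :+ y) :+ (z :+ z) := (z :+ y) :+ (z :+ y)) refl
    where open +-*-Solver
  -- With `suc h = 2 ^ ℓ`, the range splits, in units of `M`, at `2 ^ ℓ` and `2 ^ suc ℓ`: `Z` is the
  -- first piece, `Y` the last doubling, and the remaining `r` units are dropped.
  j≡ : j ≡ h + (suc h + r)
  j≡ = sym (trans (sym (+-assoc h (suc h) r)) (m+[n∸m]≡n
    (≤-pred (subst (_≤ suc j) (cong (suc h +_) (+-identityʳ (suc h))) 2^1+ℓ≤1+j))))
  jM≡ : j * M ≡ h * M + (suc h * M + r * M)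
  jM≡ = trans (cong (_* M) j≡) (trans (*-distribʳ-+ M h (suc h + r)) (cong (h * M +_) (*-distribʳ-+ M (suc h) r)))
  pieces : Z ℚ.+ Y ℚ.≤ harmonic M (j * M)
  pieces = begin
    Z ℚ.+ Y
      ≤⟨ ℚ.+-monoʳ-≤ Z (ℚ.≤-trans (ℚ.≤-reflexive (sym (ℚ.+-identityʳ Y)))
           (ℚ.+-monoʳ-≤ Y (harmonic≥0 (suc h * M + suc h * M) (r * M)))) ⟩
    Z ℚ.+ (Y ℚ.+ harmonic (suc h * M + suc h * M) (r * M))
      ≡⟨ cong (Z ℚ.+_) (sym (harmonic-++ (suc h * M) (suc h * M) (r * M))) ⟩
    Z ℚ.+ harmonic (M + h * M) (suc h * M + r * M)
      ≡⟨ sym (harmonic-++ M (h * M) (suc h * M + r * M)) ⟩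
    harmonic M (h * M + (suc h * M + r * M))
      ≡⟨ cong (harmonic M) (sym jM≡) ⟩
    harmonic M (j * M) ∎

logSeq-lower : ∀ ℓ k N → 2 ^ ℓ ≤ k → ι ℓ ℚ.≤ logSeq k N ℚ.+ logSeq k N
logSeq-lower ℓ zero    N h = contradiction (2^-pos ℓ) (≤⇒≯ h)
logSeq-lower ℓ (suc j) N h = harmonic-dyadic ℓ N j h

*ι-monoʳ : ∀ m {p q} → p ℚ.≤ q → ι m ℚ.* p ℚ.≤ ι m ℚ.* q
*ι-monoʳ m = ℚ.*-monoˡ-≤-nonNeg (ι m) {{nonNegative (0≤ι m)}}

module _ (C : ℕ) where
  εℚ : ℚ
  εℚ = recip (ι (suc C))

  -- A single index `N` of the real inequality suffices, because `logSeq-lower` holds at every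
  -- index; the gap `δ` is dropped. The second `n ^ 2` appears since `logSeq` is only known to be at
  -- least half of `ℓ`.
  edgeBound : ∀ n k ℓ e (2≤k : 2 ≤ k) → 2 ^ ℓ ≤ k →
    fromℕ e <ᴿ fromℚ εℚ *ᴿ (fromℕ (n ^ 2) /ᴿ (fromℕ (k ^ 2) *ᴿ log k) ⟨ k²log-pos k 2≤k ⟩) →
    suc C * (e * (k ^ 2 * ℓ)) ≤ n ^ 2 + n ^ 2
  edgeBound n k@(suc k′) ℓ e 2≤k 2^ℓ≤k (δ , 0<δ , N , lt) = ι-cancel-≤ (begin
    ι (suc C * (e * (k ^ 2 * ℓ)))
      ≡⟨ trans (ι-* (suc C) (e * (k ^ 2 * ℓ))) (cong (ι (suc C) ℚ.*_) (trans (ι-* e (k ^ 2 * ℓ)) (cong (ι e ℚ.*_) (ι-* (k ^ 2) ℓ)))) ⟩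
    c ℚ.* (ι e ℚ.* (κ ℚ.* ι ℓ))
      ≤⟨ *ι-monoʳ (suc C) (*ι-monoʳ e (*ι-monoʳ (k ^ 2) (logSeq-lower ℓ k N 2^ℓ≤k))) ⟩
    c ℚ.* (ι e ℚ.* (κ ℚ.* (h ℚ.+ h)))         ≡⟨ double c (ι e) κ h ⟩
    c ℚ.* (ι e ℚ.* Q) ℚ.+ c ℚ.* (ι e ℚ.* Q)   ≤⟨ ℚ.+-mono-≤ single single ⟩
    ι (n ^ 2) ℚ.+ ι (n ^ 2)                   ≡⟨ sym (ι-+ (n ^ 2) (n ^ 2)) ⟩
    ι (n ^ 2 + n ^ 2)                       ∎)
    where
    open ℚ.≤-Reasoning
    c = ι (suc C)
    κ = ι (k ^ 2)
    h = logSeq k N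
    Q = κ ℚ.* h
    ν = ι (n ^ 2)
    0<h : 0ℚ ℚ.< h
    0<h = ℚ.≰⇒> λ h≤0 → ℚ.<-irrefl refl (ℚ.<-≤-trans (0<ι 0) (ℚ.≤-trans (logSeq-lower 1 k N 2≤k)
            (ℚ.≤-trans (ℚ.+-mono-≤ h≤0 h≤0) (ℚ.≤-reflexive (ℚ.+-identityˡ 0ℚ)))))
    0<κ : 0ℚ ℚ.< κ
    0<κ = 0<ι (k′ * 1 + k′ * (k * 1))
    0<Q : 0ℚ ℚ.< Q
    0<Q = subst (ℚ._< Q) (ℚ.*-zeroʳ κ) (ℚ.*-monoʳ-<-pos κ {{positive 0<κ}} 0<h)
    e≤ : ι e ℚ.≤ εℚ ℚ.* (ν ℚ.* recip Q)
    e≤ = ℚ.≤-trans (subst (ℚ._≤ ι e ℚ.+ δ) (ℚ.+-identityʳ (ι e)) (ℚ.+-monoʳ-≤ (ι e) (ℚ.<⇒≤ 0<δ))) (lt N ≤-refl)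
    double : ∀ c e κ h → c ℚ.* (e ℚ.* (κ ℚ.* (h ℚ.+ h))) ≡ c ℚ.* (e ℚ.* (κ ℚ.* h)) ℚ.+ c ℚ.* (e ℚ.* (κ ℚ.* h))
    double = solve 4 (λ c e κ h → c :* (e :* (κ :* (h :+ h))) := c :* (e :* (κ :* h)) :+ c :* (e :* (κ :* h))) refl
      where open +-*-Solver
    regroup : ∀ c ε ν R Q → c ℚ.* ((ε ℚ.* (ν ℚ.* R)) ℚ.* Q) ≡ (ε ℚ.* c) ℚ.* (ν ℚ.* (R ℚ.* Q))
    regroup = solve 5 (λ c ε ν R Q → c :* ((ε :* (ν :* R)) :* Q) := (ε :* c) :* (ν :* (R :* Q))) refl
      where open +-*-Solver
    single : c ℚ.* (ι e ℚ.* Q) ℚ.≤ ν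
    single = begin
      c ℚ.* (ι e ℚ.* Q)                           ≤⟨ *ι-monoʳ (suc C) (ℚ.*-monoʳ-≤-nonNeg Q {{nonNegative (ℚ.<⇒≤ 0<Q)}} e≤) ⟩
      c ℚ.* ((εℚ ℚ.* (ν ℚ.* recip Q)) ℚ.* Q)      ≡⟨ regroup c εℚ ν (recip Q) Q ⟩
      (εℚ ℚ.* c) ℚ.* (ν ℚ.* (recip Q ℚ.* Q))      ≡⟨ cong₂ ℚ._*_ (recip-inverse c (0<ι C)) (cong (ν ℚ.*_) (recip-inverse Q 0<Q)) ⟩
      1ℚ ℚ.* (ν ℚ.* 1ℚ)                           ≡⟨ trans (ℚ.*-identityˡ _) (ℚ.*-identityʳ ν) ⟩
      ν                                           ∎

  ε-pos : 0ᴿ <ᴿ fromℚ εℚ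
  ε-pos = εℚ , recip-pos (ι (suc C)) (0<ι C) , 0 , λ _ _ → ℚ.≤-reflexive (ℚ.+-identityˡ εℚ)

-- Choice of the constant and the remaining cases

module _ (C c : ℕ) (640c≤C : 320 * c + 320 * c ≤ C) (8≤C : 8 ≤ C)
  (sieve : SieveBound c)
  where
  open ≤-Reasoning

  -- The counting argument requires `2 * k ≤ n`. A single edge already forces this through the bound
  -- on the edges, so only the empty graph is treated apart, with the progression 1, ..., k.
  fewEdges : ∀ n k → 2 ≤ k → k ≤ n → (G : Graph n) →
             suc C * (edgeCount G * (k ^ 2 * lg k)) ≤ n ^ 2 + n ^ 2 →
             ∃[ S ] IsAP k {n} S × Independent G S
  fewEdges n k 2≤k k≤n G few = cases (edgeCount G ≟ 0)
    where
    e = edgeCount G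
    ℓ = lg k
    sq : ∀ m → m ^ 2 ≡ m * m
    sq m = cong (m *_) (*-identityʳ m)
    0<k : 0 < k
    0<k = ≤-trans (s≤s z≤n) 2≤k
    0<ℓ : 0 < ℓ
    0<ℓ = ≤-pred (2^-cancel-< {1} {suc ℓ} (≤-<-trans 2≤k (<2^1+lg k)))
    empty : ∀ {A : Set} (xs : List A) (f : A → ℕ) → length xs ≡ 0 → ∑ᴸ xs f ≡ 0
    empty [] f _ = refl
    few′ : suc C * (e * (k * k * ℓ)) ≤ n * n + n * n
    few′ = subst₂ (λ a b → suc C * (e * (a * ℓ)) ≤ b + b) (sq k) (sq n) few
    cases : Dec (e ≡ 0) → ∃[ S ] IsAP k {n} S × Independent G S
    cases (yes e≡0) = independentAP G k 0 1 (s≤s z≤n)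
      (λ i i<k → <-≤-trans (subst (_< k) (sym (*-identityʳ i)) i<k) k≤n)
      (empty (edges G) _ e≡0)
    cases (no e≢0) = Assembly.assemble G k ℓ c 0<ℓ (2^lg≤ k 0<k) (<2^1+lg k) 2k≤n sieve enough
      where
      0<e : 0 < e
      0<e = n≢0⇒n>0 e≢0
      x = e * (k * k * ℓ)
      k²≤x : k * k ≤ x
      k²≤x = begin
        k * k                     ≡⟨ sym (trans (+-identityʳ _) (*-identityʳ _)) ⟩
        1 * (k * k * 1)       ≤⟨ *-mono-≤ 0<e (*-monoʳ-≤ (k * k) 0<ℓ) ⟩
        x                           ∎
      half-< : ∀ {a b} → a + a < b + b → a < b
      half-< h = ≰⇒> λ b≤a → <⇒≱ h (+-mono-≤ b≤a b≤a)
      2k≤n : 2 * k ≤ n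
      -- If `n < 2k`, then `2n² < 8k² ≤ suc C * x ≤ 2n²`, using that `e` and `ℓ` are at least 1.
      2k≤n = ≮⇒≥ λ n<2k → <⇒≱ (+-mono-< (*-mono-< n<2k n<2k) (*-mono-< n<2k n<2k)) (begin
        2 * k * (2 * k) + 2 * k * (2 * k)   ≡⟨ lemma k ⟩
        8 * (k * k)                                   ≤⟨ *-mono-≤ (≤-trans 8≤C (n≤1+n C)) k²≤x ⟩
        suc C * x                                       ≤⟨ few′ ⟩
        n * n + n * n                               ∎)
        where lemma : ∀ k → 2 * k * (2 * k) + 2 * k * (2 * k) ≡ 8 * (k * k)
              lemma = solve-∀
      0<x : 0 < x
      0<x = <-≤-trans (*-mono-< 0<k 0<k) k²≤x
      enough : 320 * c * x < n * n
      enough = half-< (begin-strict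
        320 * c * x + 320 * c * x    ≡⟨ sym (*-distribʳ-+ x (320 * c) (320 * c)) ⟩
        (320 * c + 320 * c) * x        ≤⟨ *-monoˡ-≤ x 640c≤C ⟩
        -- The passage from `C` to `suc C` supplies the strict inequality, as `x` is positive.
        C * x                                <⟨ m<n+m (C * x) 0<x ⟩
        suc C * x                            ≤⟨ few′ ⟩
        n * n + n * n                    ∎)

abstract
  -- Any value from `640 * 137 = 87680` on would do. It is abstract so that the numeral is not
  -- unfolded in the types of the final proof.
  C : ℕ
  C = 100000

  C-large : 320 * 137 + 320 * 137 ≤ C
  C-large = ≤ᵇ⇒≤ _ _ _

  8≤C : 8 ≤ C
  8≤C = ≤ᵇ⇒≤ _ _ _

theorem2 : ∃[ ε ] 0ᴿ <ᴿ ε ×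
    (∀ (n k : ℕ) (2≤k : 2 ≤ k) → k ≤ n → (G : Graph n) →
    fromℕ (edgeCount G) <ᴿ
    ε *ᴿ (fromℕ (n ^ 2) /ᴿ (fromℕ (k ^ 2) *ᴿ log k) ⟨ k²log-pos k 2≤k ⟩) →
    ∃[ S ] IsAP k {n} S × Independent G S)
theorem2 = fromℚ (εℚ C) , ε-pos C , λ n k 2≤k k≤n G few →
  fewEdges C 137 C-large 8≤C sieveBound n k 2≤k k≤n G (edgeBound C n k (lg k) (edgeCount G) 2≤k (2^lg≤ k (≤-trans (s≤s z≤n) 2≤k)) few)
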